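{- For $n\ge2$, the pairs of statistics $(inv_D,nmin_D)$ and $(sor_D,\tilde l_D')$ are equidistributed over $D_n$, and $$\sum_{\sigma\in D_n}q^{inv_D(\sigma)}t^{nmin_D(\sigma)}=\sum_{\sigma\in D_n}q^{sor_D(\sigma)}t^{\tilde l_D'(\sigma)}=\prod_{r=1}^{n-1}\bigl(1+q^rt+qt\,[2r]_q\bigr).$$
   Context: $B_n$ is the group of bijections $\sigma$ of $\{\pm1,\ldots,\pm n\}$ with $\sigma(-i)=-\sigma(i)$, written $\sigma_1\cdots\sigma_n$ with $\sigma_i=\sigma(i)$ and with composition as product; $D_n$ is its subgroup of elements with an even number of negative entries $\sigma_i$. $[m]_q=1+q+\cdots+q^{m-1}$. $inv_D(\sigma)=|\{(i,j):1\le i<j\le n,\sigma_i>\sigma_j\}|+|\{(i,j):1\le i<j\le n,-\sigma_i>\sigma_j\}|$. $nmin_D(\sigma)=|\{i:\sigma_i>|\sigma_j|\text{ for some }j>i\}|+|\{i:\sigma_i<-1\}|$. Reflections: for $1\le i<j\le n$, $(i,j)$ exchanges $i,j$ and exchanges $-i,-j$; $(-i,j)$ exchanges $-i,j$ and exchanges $i,-j$; for $1\le j\le n$, $(-j,j)$ exchanges $j$ and $-j$ (all other points fixed). $T^B$ is the set of all these. Every $\sigma\in D_n$ factors uniquely as $(i_1,j_1)\cdots(i_k,j_k)$ with factors in $T^B$ and $0<j_1<\cdots<j_k\le n$, and $sor_D(\sigma)=\sum_{r=1}^k(j_r-i_r-2\chi(i_r<0))$, $\chi$ the indicator. Let $t_{ij}=(i,j)$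 for $1\le|i|<j\le n$, $t_{ -i,i}=(-i,i)(-1,1)$ for $1<i\le n$, and $T^D=\{t_{ij}:1\le|i|<j\le n\}\cup\{t_{ -i,i}:1<i\le n\}$. $\tilde l_D'(\sigma)$ is the minimal number of elements of $T^D$ whose product is $\sigma$. -}

module Defs where

open import Data.Bool using (Bool; true; false; _∧_; _∨_; not; if_then_else_)
open import Data.Nat as ℕ using (ℕ; zero; suc; _+_; _∸_; _^_; _*_)
import Data.Nat.Properties as ℕP
open import Data.Integer as ℤ using (ℤ; +_; -[1+_]; ∣_∣)
import Data.Integer.Properties as ℤP
open import Data.List using (List; []; _∷_; _++_; map; concatMap; filterᵇ; length; foldr; upTo)
open import Data.Nat.ListAction using (sum)
open import Data.Bool.ListAction using (any)
open import Data.Vec as Vec using (Vec; []; _∷_; tabulate; toList)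
import Data.Vec.Properties as VecP
open import Data.Fin using (Fin; toℕ)
open import Data.Product using (_×_; _,_)
open import Relation.Nullary.Decidable using (⌊_⌋)

-- Signed permutations are represented in one-line notation as
-- Vec ℤ n :  σ = σ_1 ... σ_n  (position k of the vector holds σ(k+1)).

infix 4 _<ᶻ_ _==ᶻ_ _==ᵛ_
infixr 9 _∘ᵛ_
_<ᶻ_ : ℤ → ℤ → Bool
x <ᶻ y = ⌊ x ℤ.<? y ⌋

_==ᶻ_ : ℤ → ℤ → Bool
x ==ᶻ y = ⌊ x ℤ.≟ y ⌋

_==ᵛ_ : ∀ {n} → Vec ℤ n → Vec ℤ n → Bool
σ ==ᵛ τ = ⌊ VecP.≡-dec ℤ._≟_ σ τ ⌋

count : {A : Set} → (A → Bool) → List A → ℕ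
count p xs = length (filterᵇ p xs)

-- value σ(k) for k ≥ 1 (σ(k) for k = position k-1); 0 out of range
atPos : ∀ {n} → Vec ℤ n → ℕ → ℤ
atPos []       _             = + 0
atPos (x ∷ xs) zero          = x
atPos (x ∷ xs) (suc k)       = atPos xs k

apply : ∀ {n} → Vec ℤ n → ℤ → ℤ
apply σ (+ zero)   = + 0
apply σ (+ suc k)  = atPos σ k
apply σ -[1+ k ]   = ℤ.- atPos σ k

_∘ᵛ_ : ∀ {n} → Vec ℤ n → Vec ℤ n → Vec ℤ n
σ ∘ᵛ τ = Vec.map (apply σ) τ

idᵛ : ∀ n → Vec ℤ n
idᵛ n = tabulate (λ (k : Fin n) → + suc (toℕ k))

prodᵛ : ∀ {n} → List (Vec ℤ n) → Vec ℤ n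
prodᵛ {n} = foldr _∘ᵛ_ (idᵛ n)

points : ℕ → List ℤ
points n = map (λ k → -[1+ k ]) (upTo n) ++ map (λ k → + suc k) (upTo n)

allVecs : {A : Set} → List A → (n : ℕ) → List (Vec A n)
allVecs xs zero    = [] ∷ []
allVecs xs (suc n) = concatMap (λ x → map (x ∷_) (allVecs xs n)) xs

distinctAbs : List ℤ → Bool
distinctAbs []       = true
distinctAbs (x ∷ xs) = not (any (λ y → ⌊ ∣ x ∣ ℕ.≟ ∣ y ∣ ⌋) xs) ∧ distinctAbs xs

even : ℕ → Bool
even zero          = true
even (suc zero)    = false
even (suc (suc k)) = even k

-- a word with entries in {±1,…,±n} is a signed permutation iff the
-- absolute values of its entries are distinct
isB : ∀ {n} → Vec ℤ n → Bool
isB σ = distinctAbs (toList σ)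

negCount : ∀ {n} → Vec ℤ n → ℕ
negCount σ = count (λ x → x <ᶻ + 0) (toList σ)

isD : ∀ {n} → Vec ℤ n → Bool
isD σ = isB σ ∧ even (negCount σ)

-- the elements of D_n, each listed exactly once
Dlist : (n : ℕ) → List (Vec ℤ n)
Dlist n = filterᵇ isD (allVecs (points n) n)

pairsL : List ℤ → List (ℤ × ℤ)
pairsL []       = []
pairsL (x ∷ xs) = map (x ,_) xs ++ pairsL xs

invD : ∀ {n} → Vec ℤ n → ℕ
invD σ = count (λ { (a , b) → b <ᶻ a }) (pairsL (toList σ))
       + count (λ { (a , b) → b <ᶻ (ℤ.- a) }) (pairsL (toList σ))

nminL : List ℤ → ℕ
nminL []       = 0
nminL (x ∷ xs) = (if any (λ y → (+ ∣ y ∣) <ᶻ x) xs then 1 else 0) + nminL xs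

nminD : ∀ {n} → Vec ℤ n → ℕ
nminD σ = nminL (toList σ) + count (λ x → x <ᶻ ℤ.-[1+ 0 ]) (toList σ)

-- the map exchanging a ↔ b and -a ↔ -b, fixing all other points
-- (for a = -b this is the map exchanging b and -b)
reflMap : ℤ → ℤ → ℤ → ℤ
reflMap a b x =
  if x ==ᶻ a then b else
  if x ==ᶻ b then a else
  if x ==ᶻ (ℤ.- a) then ℤ.- b else
  if x ==ᶻ (ℤ.- b) then ℤ.- a else x

reflB : ∀ n → ℤ × ℕ → Vec ℤ n
reflB n (i , j) = tabulate (λ (k : Fin n) → reflMap i (+ j) (+ suc (toℕ k)))

-- admissible first coordinates i of reflections (i , j) ∈ T^B :
-- i ∈ {-j, …, -1} ∪ {1, …, j-1}
firstB : ℕ → List ℤ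
firstB j = map (λ k → -[1+ k ]) (upTo j) ++ map (λ k → + suc k) (upTo (j ∸ 1))

incFacts : ℕ → List (List (ℤ × ℕ))
incFacts zero    = [] ∷ []
incFacts (suc m) = incFacts m
  ++ concatMap (λ f → map (λ i → f ++ ((i , suc m) ∷ [])) (firstB (suc m))) (incFacts m)

-- j - i - 2 χ(i < 0)   (always ≥ 0 for admissible (i , j))
sorTerm : ℤ × ℕ → ℕ
sorTerm (+ a , j)      = j ∸ a
sorTerm (-[1+ a ] , j) = j + suc a ∸ 2

-- sor_D σ : the sum over the (unique) factorization of σ
sorD : ∀ {n} → Vec ℤ n → ℕ
sorD {n} σ with filterᵇ (λ f → prodᵛ (map (reflB n) f) ==ᵛ σ) (incFacts n)
... | []      = 0
... | f ∷ _   = sum (map sorTerm f)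

TD : ∀ n → List (Vec ℤ n)
TD n = concatMap (λ j → map (λ i → reflB n (i , j)) (tsFirst j)) (map suc (upTo n))
    ++ map (λ i → reflB n (-[1+ i ] , suc i) ∘ᵛ reflB n (-[1+ 0 ] , 1))
           (map suc (upTo (n ∸ 1)))
  where
  tsFirst : ℕ → List ℤ
  tsFirst j = map (λ k → -[1+ k ]) (upTo (j ∸ 1)) ++ map (λ k → + suc k) (upTo (j ∸ 1))

allWords : {A : Set} → List A → ℕ → List (List A)
allWords xs zero    = [] ∷ []
allWords xs (suc k) = concatMap (λ x → map (x ∷_) (allWords xs k)) xs

prodOfLen : ∀ {n} → Vec ℤ n → ℕ → Bool
prodOfLen {n} σ k = any (λ w → prodᵛ w ==ᵛ σ) (allWords (TD n) k)

searchFrom : ∀ {n} → Vec ℤ n → ℕ → ℕ → ℕ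
searchFrom σ m zero       = m
searchFrom σ m (suc fuel) = if prodOfLen σ m then m else searchFrom σ (suc m) fuel

-- minimal number of elements of T^D with product σ.  A shortest word
-- has length < |D_n| ≤ (2n)^n, so the search bound is never reached
-- for σ ∈ D_n (T^D generates D_n).
lD' : ∀ {n} → Vec ℤ n → ℕ
lD' {n} σ = searchFrom σ 0 ((2 * n) ^ n)

-- polynomials in q, t with ℕ coefficients, as multisets (lists) of
-- monomials q^a t^b  ↦  (a , b)

genFun : ∀ n → (Vec ℤ n → ℕ) → (Vec ℤ n → ℕ) → List (ℕ × ℕ)
genFun n f g = map (λ σ → (f σ , g σ)) (Dlist n)

factor : ℕ → List (ℕ × ℕ)
factor r = (0 , 0) ∷ (r , 1) ∷ map (λ k → (suc k , 1)) (upTo (2 * r))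

polyMul : List (ℕ × ℕ) → List (ℕ × ℕ) → List (ℕ × ℕ)
polyMul p q = concatMap (λ { (a , b) → map (λ { (c , d) → (a + c , b + d) }) q }) p

prodPoly : ℕ → List (ℕ × ℕ)
prodPoly n = foldr (λ r acc → polyMul (factor r) acc) ((0 , 0) ∷ []) (map suc (upTo (n ∸ 1)))

{-# OPTIONS --safe #-}
module Submission where

-- Every signed permutation τ of 1, …, m + 1 is obtained in exactly one way from a signed permutation σ
-- of 1, …, m by a choice of a sign s and a position p for the letter s (m + 1). There are two such
-- growth rules: inserting the letter at position p, and multiplying σ by (s p , m + 1), which for s p = m + 1 is the identity.
-- The first adds q^d t^[d > 0] to (inv_D , nmin_D) and the second adds the same monomial to
-- (sor_D , number of factors (i , j) with j > 1), where d = m + 1 − p for s = + and d = m + p − 1 for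
-- s = −. The sign of the letter 1 influences neither pair, so it can be used to correct the parity,
-- and the sum over D_n is the product of the factors over m = 1, …, n − 1.
--
-- It remains to see that the number of factors with j > 1 is the length in T^D. Moving all the
-- factors (−1 , 1) of a word in T^D to one end turns it into a word of the same length in T^B, so the
-- point is that multiplication by a reflection adds at most one factor, and by (−1 , 1) none with j > 1.
-- Conversely the factorization yields a word in T^D after replacing (−j , j) by (−j , j)(−1 , 1).

open import Defs
open import Data.Bool using (Bool; true; false; T; not; _∧_; _xor_)
open import Data.Bool.Properties using (T-≡; T-∧; not-involutive; T?)
open import Data.Bool.ListAction using (any)
open import Data.Nat as ℕ using (ℕ; zero; suc; _+_; _*_; _∸_; _⊓_; _≤_; _<_; z≤n; s≤s)
import Data.Nat.Properties as ℕP
open import Algebra.Properties.CommutativeSemigroup ℕP.+-commutativeSemigroup using (interchange; x∙yz≈y∙xz)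
open import Data.Integer as ℤ using (ℤ; +_; -[1+_]; ∣_∣)
import Data.Integer.Properties as ℤP
open import Data.Fin as Fin using (Fin; zero; suc; toℕ; fromℕ<)
import Data.Fin.Properties as FinP
open import Data.Sign as Sign using (Sign)
open import Data.Product using (_×_; _,_; proj₁; proj₂; ∃; ∃₂)
open import Data.Sum using (_⊎_; inj₁; inj₂)
open import Data.Empty using (⊥-elim)
open import Data.Vec as Vec using (Vec; []; _∷_; toList; lookup; tabulate)
import Data.Vec.Properties as VecP
open import Data.List as List using (List; []; _∷_; _++_; map; concatMap; filterᵇ; length; foldr; upTo; downFrom; allFin; applyUpTo; cartesianProductWith)
import Data.List.Properties as ListP
open import Data.List.Relation.Unary.All as All using (All; []; _∷_)
import Data.List.Relation.Unary.All.Properties as AllP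
open import Data.List.Relation.Unary.Any using (here; there)
import Data.List.Relation.Unary.Any.Properties as AnyP
open import Data.List.Relation.Unary.AllPairs as AllPairs using (AllPairs; []; _∷_)
import Data.List.Relation.Unary.AllPairs.Properties as AllPairsP
open import Data.List.Relation.Unary.Unique.Propositional using (Unique)
import Data.List.Relation.Unary.Unique.Propositional.Properties as UniqueP
open import Data.List.Membership.Propositional using (_∈_; find; lose)
import Data.List.Membership.Propositional.Properties as ∈P
open import Data.List.Relation.Binary.Pointwise as Pointwise using (Pointwise; []; _∷_)
open import Data.List.Relation.Binary.Permutation.Propositional
  using (_↭_; refl; prep; swap; trans; ↭-refl; ↭-prep; ↭-swap; ↭-reflexive; ↭-sym; ↭-trans; ↭⇒↭ₛ; module PermutationReasoning)
open import Data.List.Relation.Binary.Permutation.Propositional.Properties as ↭P using ()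
import Data.List.Relation.Binary.Permutation.Setoid.Properties as ↭ₛP
open import Data.List.Relation.Binary.BagAndSetEquality using (∼bag⇒↭)
open import Data.List.Membership.Propositional.Properties.WithK using (unique∧set⇒bag)
open import Data.Nat.ListAction using (sum)
import Data.Nat.ListAction.Properties as SumP
open import Function using (_∘_; id; _on_)
open import Function.Bundles using (mk⇔; Equivalence)
open import Relation.Nullary using (¬_; Dec; yes; no; contradiction)
open import Relation.Nullary.Decidable using (⌊_⌋; toWitness; fromWitness)
open import Relation.Binary.PropositionalEquality
  using (_≡_; _≢_; refl; sym; cong; cong₂; subst; setoid; module ≡-Reasoning) renaming (trans to ≡-trans)

-- Lists

-- The obstacle is that D_n is not stable under growth: removing the largest letter may change the
-- parity of the number of negative entries. Growth therefore takes place in B_n and parity is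
-- settled at the end. Two families grow by the same choices, one from the word 1 and one from the
-- word -1. A step changes the parity according to its choice alone, so corresponding words have the
-- same monomial and opposite parities, and exactly one of them lies in D_n. For a positive letter
-- the degree d runs through 0, ..., m, and for a negative one through m, ..., 2m. The value m is
-- met twice, which is why each factor has a separate term q^r t beside qt [2r]. For m = 0 both
-- degrees vanish, so the letter 1 leaves no trace in the monomial. The monomial is carried along by
-- growth and not computed from the word. A statistic then needs to be compared with it for a single
-- step only. Since a word has only one growth history, whatever history is produced, be it from a
-- word in T^D or from a factorization, yields the same monomial. Both the minimality of the length
-- and the value of sor_D rest on this.

unique-set⇒↭ : {A : Set} {xs ys : List A} → Unique xs → Unique ys →
  (∀ {x} → x ∈ xs → x ∈ ys) → (∀ {x} → x ∈ ys → x ∈ xs) → xs ↭ ys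
unique-set⇒↭ xs! ys! to from = ∼bag⇒↭ (unique∧set⇒bag xs! ys! (mk⇔ to from))

Unique-resp-↭ : {A : Set} {xs ys : List A} → xs ↭ ys → Unique xs → Unique ys
Unique-resp-↭ {A} p = ↭ₛP.Unique-resp-↭ (setoid A) (↭⇒↭ₛ p)

∈-filterᵇ⁺ : {A : Set} (p : A → Bool) {x : A} {xs : List A} → x ∈ xs → T (p x) → x ∈ filterᵇ p xs
∈-filterᵇ⁺ p = ∈P.∈-filter⁺ (T? ∘ p)

∈-filterᵇ⁻ : {A : Set} (p : A → Bool) {x : A} {xs : List A} → x ∈ filterᵇ p xs → x ∈ xs × T (p x)
∈-filterᵇ⁻ p {xs = xs} = ∈P.∈-filter⁻ (T? ∘ p) {xs = xs}

∈-concatMap⁺ : {A B : Set} (f : A → List B) {x : A} {y : B} {xs : List A} →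
  x ∈ xs → y ∈ f x → y ∈ concatMap f xs
∈-concatMap⁺ f x∈xs y∈fx = ∈P.∈-concat⁺′ y∈fx (∈P.∈-map⁺ f x∈xs)

∈-concatMap⁻ : {A B : Set} (f : A → List B) {y : B} (xs : List A) →
  y ∈ concatMap f xs → ∃ λ x → x ∈ xs × y ∈ f x
∈-concatMap⁻ f xs y∈ with ∈P.∈-concat⁻′ (map f xs) y∈
... | _ , y∈ys , ys∈ with ∈P.∈-map⁻ f ys∈
... | x , x∈xs , refl = x , x∈xs , y∈ys

module _ {A B C : Set} (f : A → B → C) where

  -- The keys `g` and `h` allow weighted words to be told apart by the word alone, and `P` carries
  -- signedness, under which a growth step is injective.
  AllPairs-cartesianProductWith : {D E : Set} (g : C → D) (h : A → E) (P : A → Set) →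
    (∀ {x x′ y y′} → P x → P x′ → g (f x y) ≡ g (f x′ y′) → h x ≡ h x′ × y ≡ y′) →
    ∀ {xs ys} → All P xs → AllPairs (_≢_ on h) xs → Unique ys →
    AllPairs (_≢_ on g) (cartesianProductWith f xs ys)
  AllPairs-cartesianProductWith g h P inj [] [] ys! = []
  AllPairs-cartesianProductWith g h P inj {x ∷ xs} {ys} (px ∷ pxs) (x∉xs ∷ xs!) ys! =
    AllPairsP.++⁺
      (AllPairsP.map⁺ (AllPairs.map (λ y≢y′ e → y≢y′ (proj₂ (inj px px e))) ys!))
      (AllPairs-cartesianProductWith g h P inj pxs xs! ys!)
      (All.tabulate λ {z} z∈ → All.tabulate λ {z′} z′∈ → apart z∈ z′∈)
    where
    apart : ∀ {z z′} → z ∈ map (f x) ys → z′ ∈ cartesianProductWith f xs ys → g z ≢ g z′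
    apart z∈ z′∈ e with ∈P.∈-map⁻ (f x) z∈ | ∈P.∈-cartesianProductWith⁻ f xs ys z′∈
    ... | y , _ , refl | x′ , y′ , x′∈xs , _ , refl =
      All.lookup x∉xs x′∈xs (proj₁ (inj px (All.lookup pxs x′∈xs) e))

  All-cartesianProductWith : {P : A → Set} {Q : C → Set} → (∀ {x} y → P x → Q (f x y)) →
    ∀ {xs} ys → All P xs → All Q (cartesianProductWith f xs ys)
  All-cartesianProductWith pq {xs} ys pxs = All.tabulate λ z∈ → case z∈
    where
    case : ∀ {z} → z ∈ cartesianProductWith f xs ys → _
    case z∈ with ∈P.∈-cartesianProductWith⁻ f xs ys z∈
    ... | x , y , x∈xs , _ , refl = pq y (All.lookup pxs x∈xs)

  Pointwise-cartesianProductWith : {R : A → A → Set} {S : C → C → Set} →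
    (∀ {x x′} y → R x x′ → S (f x y) (f x′ y)) →
    ∀ {xs xs′} ys → Pointwise R xs xs′ →
    Pointwise S (cartesianProductWith f xs ys) (cartesianProductWith f xs′ ys)
  Pointwise-cartesianProductWith rs ys [] = []
  Pointwise-cartesianProductWith rs ys (r ∷ rxs) =
    Pointwise.++⁺ (Pointwise.map⁺ (f _) (f _) (Pointwise.refl (λ {y} → rs y r)))
                  (Pointwise-cartesianProductWith rs ys rxs)

-- Generating polynomials

infixl 6 _⊕_
_⊕_ : ℕ × ℕ → ℕ × ℕ → ℕ × ℕ
(a , b) ⊕ (c , d) = a + c , b + d

⊕-assoc : ∀ u v w → (u ⊕ v) ⊕ w ≡ u ⊕ (v ⊕ w)
⊕-assoc (a , b) (c , d) (e , f) = cong₂ _,_ (ℕP.+-assoc a c e) (ℕP.+-assoc b d f)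

⊕-identityʳ : ∀ u → u ⊕ (0 , 0) ≡ u
⊕-identityʳ (a , b) = cong₂ _,_ (ℕP.+-identityʳ a) (ℕP.+-identityʳ b)

polyMul-∷ : ∀ u p q → polyMul (u ∷ p) q ≡ map (u ⊕_) q ++ polyMul p q
polyMul-∷ u p q = cong (_++ polyMul p q) (shifted q)
  where
  shifted : ∀ q → List.map _ q ≡ map (u ⊕_) q
  shifted []      = refl
  shifted (_ ∷ q) = cong (_ ∷_) (shifted q)

polyMul-cartesian : ∀ p q → polyMul p q ≡ cartesianProductWith _⊕_ p q
polyMul-cartesian []      q = refl
polyMul-cartesian (u ∷ p) q = ≡-trans (polyMul-∷ u p q) (cong (map (u ⊕_) q ++_) (polyMul-cartesian p q))

polyMul-++ : ∀ p q r → polyMul (p ++ q) r ≡ polyMul p r ++ polyMul q r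
polyMul-++ p q r rewrite polyMul-cartesian (p ++ q) r | polyMul-cartesian p r | polyMul-cartesian q r =
  ListP.cartesianProductWith-distribʳ-++ _⊕_ p q r

polyMul-shift : ∀ u q r → polyMul (map (u ⊕_) q) r ≡ map (u ⊕_) (polyMul q r)
polyMul-shift u []      r = refl
polyMul-shift u (v ∷ q) r = begin
  polyMul (u ⊕ v ∷ map (u ⊕_) q) r                        ≡⟨ polyMul-∷ (u ⊕ v) (map (u ⊕_) q) r ⟩
  map (u ⊕ v ⊕_) r ++ polyMul (map (u ⊕_) q) r            ≡⟨ cong₂ _++_ (≡-trans (ListP.map-cong (⊕-assoc u v) r) (ListP.map-∘ r)) (polyMul-shift u q r) ⟩
  map (u ⊕_) (map (v ⊕_) r) ++ map (u ⊕_) (polyMul q r)   ≡⟨ ListP.map-++ (u ⊕_) (map (v ⊕_) r) (polyMul q r) ⟨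
  map (u ⊕_) (map (v ⊕_) r ++ polyMul q r)                ≡⟨ cong (map (u ⊕_)) (polyMul-∷ v q r) ⟨
  map (u ⊕_) (polyMul (v ∷ q) r)                          ∎
  where open ≡-Reasoning

polyMul-assoc : ∀ p q r → polyMul (polyMul p q) r ≡ polyMul p (polyMul q r)
polyMul-assoc []      q r = refl
polyMul-assoc (u ∷ p) q r = begin
  polyMul (polyMul (u ∷ p) q) r                           ≡⟨ cong (λ x → polyMul x r) (polyMul-∷ u p q) ⟩
  polyMul (map (u ⊕_) q ++ polyMul p q) r                 ≡⟨ polyMul-++ (map (u ⊕_) q) (polyMul p q) r ⟩
  polyMul (map (u ⊕_) q) r ++ polyMul (polyMul p q) r     ≡⟨ cong₂ _++_ (polyMul-shift u q r) (polyMul-assoc p q r) ⟩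
  map (u ⊕_) (polyMul q r) ++ polyMul p (polyMul q r)     ≡⟨ polyMul-∷ u p (polyMul q r) ⟨
  polyMul (u ∷ p) (polyMul q r)                           ∎
  where open ≡-Reasoning

polyMul-identityˡ : ∀ p → polyMul ((0 , 0) ∷ []) p ≡ p
polyMul-identityˡ p = ≡-trans (polyMul-∷ (0 , 0) [] p) (≡-trans (ListP.++-identityʳ _) (ListP.map-id p))

polyMul-identityʳ : ∀ p → polyMul p ((0 , 0) ∷ []) ≡ p
polyMul-identityʳ []      = refl
polyMul-identityʳ (u ∷ p) = ≡-trans (polyMul-∷ u p _) (cong₂ _∷_ (⊕-identityʳ u) (polyMul-identityʳ p))

-- `prodPoly` folds to the right, so the factor with the largest index sits innermost, whereas
-- growth multiplies the finished product by it. Associativity carries it outwards.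
product-factors-++ : ∀ rs acc →
  foldr (λ r → polyMul (factor r)) acc rs ≡ polyMul (foldr (λ r → polyMul (factor r)) ((0 , 0) ∷ []) rs) acc
product-factors-++ []       acc = sym (polyMul-identityˡ acc)
product-factors-++ (r ∷ rs) acc =
  ≡-trans (cong (polyMul (factor r)) (product-factors-++ rs acc)) (sym (polyMul-assoc (factor r) (foldr (λ r → polyMul (factor r)) ((0 , 0) ∷ []) rs) acc))

prodPoly-suc : ∀ m → prodPoly (suc (suc m)) ≡ polyMul (prodPoly (suc m)) (factor (suc m))
prodPoly-suc m = begin
  foldr g one (map suc (upTo (suc m)))            ≡⟨ cong (foldr g one ∘ map suc) (ListP.upTo-∷ʳ m) ⟨
  foldr g one (map suc (upTo m ++ m ∷ []))        ≡⟨ cong (foldr g one) (ListP.map-++ suc (upTo m) (m ∷ [])) ⟩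
  foldr g one (map suc (upTo m) ++ suc m ∷ [])    ≡⟨ ListP.foldr-++ g one (map suc (upTo m)) (suc m ∷ []) ⟩
  foldr g (g (suc m) one) (map suc (upTo m))      ≡⟨ product-factors-++ (map suc (upTo m)) (g (suc m) one) ⟩
  polyMul (prodPoly (suc m)) (g (suc m) one)      ≡⟨ cong (polyMul (prodPoly (suc m))) (polyMul-identityʳ (factor (suc m))) ⟩
  polyMul (prodPoly (suc m)) (factor (suc m))     ∎
  where
  open ≡-Reasoning
  one : List (ℕ × ℕ)
  one = (0 , 0) ∷ []
  g : ℕ → List (ℕ × ℕ) → List (ℕ × ℕ)
  g r = polyMul (factor r)

cartesianProductWith-↭ : ∀ {A B C : Set} (f : A → B → C) xs {ys ys′} → ys ↭ ys′ →
  cartesianProductWith f xs ys ↭ cartesianProductWith f xs ys′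
cartesianProductWith-↭ f []       p = ↭-refl
cartesianProductWith-↭ f (x ∷ xs) p = ↭P.++⁺ (↭P.map⁺ (f x) p) (cartesianProductWith-↭ f xs p)

cartesianProductWith-↭ˡ : ∀ {A B C : Set} (f : A → B → C) {xs xs′} ys → xs ↭ xs′ →
  cartesianProductWith f xs ys ↭ cartesianProductWith f xs′ ys
cartesianProductWith-↭ˡ f ys refl         = ↭-refl
cartesianProductWith-↭ˡ f ys (prep x p)   = ↭P.++⁺ˡ (map (f x) ys) (cartesianProductWith-↭ˡ f ys p)
cartesianProductWith-↭ˡ f ys (swap x y p) =
  ↭-trans (↭P.shifts (map (f x) ys) (map (f y) ys))
          (↭P.++⁺ˡ (map (f y) ys) (↭P.++⁺ˡ (map (f x) ys) (cartesianProductWith-↭ˡ f ys p)))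
cartesianProductWith-↭ˡ f ys (trans p q)  = ↭-trans (cartesianProductWith-↭ˡ f ys p) (cartesianProductWith-↭ˡ f ys q)

-- Choices of a sign and a position, and their monomials

Choice : ℕ → Set
Choice m = Sign × Fin (suc m)

choices : ∀ m → List (Choice m)
choices m = map (Sign.+ ,_) (allFin (suc m)) ++ map (Sign.- ,_) (allFin (suc m))

choices-complete : ∀ {m} (c : Choice m) → c ∈ choices m
choices-complete {m} (Sign.+ , p) = ∈P.∈-++⁺ˡ (∈P.∈-map⁺ _ (∈P.∈-allFin p))
choices-complete {m} (Sign.- , p) = ∈P.∈-++⁺ʳ (map (Sign.+ ,_) (allFin (suc m))) (∈P.∈-map⁺ _ (∈P.∈-allFin p))

choices! : ∀ m → Unique (choices m)
choices! m = UniqueP.++⁺ (UniqueP.map⁺ (cong proj₂) (UniqueP.allFin⁺ _)) (UniqueP.map⁺ (cong proj₂) (UniqueP.allFin⁺ _)) disjoint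
  where
  disjoint : ∀ {c} → ¬ (c ∈ map (Sign.+ ,_) (allFin (suc m)) × c ∈ map (Sign.- ,_) (allFin (suc m)))
  disjoint (c∈ , c∈′) with ∈P.∈-map⁻ (Sign.+ ,_) c∈ | ∈P.∈-map⁻ (Sign.- ,_) c∈′
  ... | _ , _ , refl | _ , _ , ()

-- `toℕ` counts positions from 0; with p counted from 1 the values are m + 1 - p and m + p - 1.
degree : ∀ m → Choice m → ℕ
degree m (Sign.+ , p) = m ∸ toℕ p
degree m (Sign.- , p) = m + toℕ p

-- `1 ⊓ d` is the indicator of d > 0.
monomial : ℕ → ℕ × ℕ
monomial d = d , 1 ⊓ d

weight : ∀ {m} → Choice m → ℕ × ℕ
weight {m} c = monomial (degree m c)

map-allFin : ∀ {A : Set} n (f : ℕ → A) → map (f ∘ toℕ) (allFin n) ≡ applyUpTo f n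
map-allFin n f = ≡-trans (ListP.map-tabulate id (f ∘ toℕ)) (go n f)
  where
  go : ∀ {A : Set} n (f : ℕ → A) → List.tabulate (λ (i : Fin n) → f (toℕ i)) ≡ applyUpTo f n
  go zero    f = refl
  go (suc n) f = cong (f 0 ∷_) (go n (f ∘ suc))

applyUpTo-∸ : ∀ m → applyUpTo (m ∸_) (suc m) ≡ downFrom (suc m)
applyUpTo-∸ zero    = refl
applyUpTo-∸ (suc m) = cong (suc m ∷_) (applyUpTo-∸ m)

applyUpTo-++ : ∀ {A : Set} (f : ℕ → A) m n → applyUpTo f (m + n) ≡ applyUpTo f m ++ applyUpTo (f ∘ (_+_ m)) n
applyUpTo-++ f zero    n = refl
applyUpTo-++ f (suc m) n = cong (f 0 ∷_) (applyUpTo-++ (f ∘ suc) m n)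

applyUpTo-cong : ∀ {A : Set} {f g : ℕ → A} → (∀ k → f k ≡ g k) → ∀ n → applyUpTo f n ≡ applyUpTo g n
applyUpTo-cong e zero    = refl
applyUpTo-cong e (suc n) = cong₂ _∷_ (e 0) (applyUpTo-cong (e ∘ suc) n)

-- The positive choices give m, ..., 0 and the negative ones m, ..., 2m. One of the two copies of m
-- is moved to the front, and the rest is 0, 1, ..., 2m.
degrees-choices : ∀ m → map (degree m) (choices m) ↭ 0 ∷ m ∷ applyUpTo suc (2 * m)
degrees-choices m = begin
  map (degree m) (choices m)
    ≡⟨ ListP.map-++ (degree m) (map (Sign.+ ,_) (allFin (suc m))) _ ⟩
  map (degree m) (map (Sign.+ ,_) (allFin (suc m))) ++ map (degree m) (map (Sign.- ,_) (allFin (suc m)))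
    ≡⟨ cong₂ _++_ (≡-trans (sym (ListP.map-∘ (allFin (suc m)))) (map-allFin (suc m) (m ∸_)))
                  (≡-trans (sym (ListP.map-∘ (allFin (suc m)))) (map-allFin (suc m) (_+_ m))) ⟩
  applyUpTo (m ∸_) (suc m) ++ applyUpTo (_+_ m) (suc m)
    ≡⟨ cong (_++ applyUpTo (_+_ m) (suc m)) (≡-trans (applyUpTo-∸ m) (sym (ListP.reverse-upTo (suc m)))) ⟩
  List.reverse (upTo (suc m)) ++ applyUpTo (_+_ m) (suc m)
    ↭⟨ ↭P.++⁺ʳ _ (↭P.↭-reverse (upTo (suc m))) ⟩
  upTo (suc m) ++ applyUpTo (_+_ m) (suc m)
    ≡⟨ cong (λ x → upTo (suc m) ++ x ∷ applyUpTo ((_+_ m) ∘ suc) m) (ℕP.+-identityʳ m) ⟩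
  0 ∷ (applyUpTo suc m ++ m ∷ applyUpTo ((_+_ m) ∘ suc) m)
    ↭⟨ ↭-prep 0 (↭P.shift m (applyUpTo suc m) _) ⟩
  0 ∷ m ∷ (applyUpTo suc m ++ applyUpTo ((_+_ m) ∘ suc) m)
    ≡⟨ cong (λ x → 0 ∷ m ∷ (applyUpTo suc m ++ x)) (applyUpTo-cong (ℕP.+-suc m) m) ⟩
  0 ∷ m ∷ (applyUpTo suc m ++ applyUpTo (λ k → ℕ.suc (m + k)) m)
    ≡⟨ cong (λ x → 0 ∷ m ∷ x) (applyUpTo-++ suc m m) ⟨
  0 ∷ m ∷ applyUpTo suc (m + m)
    ≡⟨ cong (λ k → 0 ∷ m ∷ applyUpTo suc (m + k)) (ℕP.+-identityʳ m) ⟨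
  0 ∷ m ∷ applyUpTo suc (2 * m)
    ∎
  where open PermutationReasoning

-- The index starts at 1: for the letter 1 both choices have the monomial 1, whereas `factor 0`
-- contains t.
weights-choices : ∀ m → map weight (choices (suc m)) ↭ factor (suc m)
weights-choices m = begin
  map weight (choices (suc m))
    ≡⟨ ListP.map-∘ (choices (suc m)) ⟩
  map monomial (map (degree (suc m)) (choices (suc m)))
    ↭⟨ ↭P.map⁺ monomial (degrees-choices (suc m)) ⟩
  (0 , 0) ∷ (suc m , 1) ∷ map monomial (applyUpTo suc (2 * suc m))
    ≡⟨ cong (λ x → (0 , 0) ∷ (suc m , 1) ∷ x)
         (≡-trans (ListP.map-applyUpTo suc monomial (2 * suc m)) (sym (ListP.map-upTo _ (2 * suc m)))) ⟩
  factor (suc m)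
    ∎
  where open PermutationReasoning

-- Signed permutations

letter : Sign → ℕ → ℤ
letter Sign.+ k = + suc k
letter Sign.- k = -[1+ k ]

∣letter∣ : ∀ s k → ∣ letter s k ∣ ≡ suc k
∣letter∣ Sign.+ k = refl
∣letter∣ Sign.- k = refl

letter-injective : ∀ {s s′ k k′} → letter s k ≡ letter s′ k′ → s ≡ s′ × k ≡ k′
letter-injective {Sign.+} {Sign.+} refl = refl , refl
letter-injective {Sign.-} {Sign.-} refl = refl , refl

letter-surjective : ∀ x {k} → ∣ x ∣ ≡ suc k → ∃ λ s → x ≡ letter s k
letter-surjective (+ suc k)  refl = Sign.+ , refl
letter-surjective (-[1+ k ]) refl = Sign.- , refl

abs : ∀ {n} → Vec ℤ n → List ℕ
abs σ = map ∣_∣ (toList σ)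

InRange : ℕ → ℕ → Set
InRange n a = 1 ≤ a × a ≤ n

Signed : ∀ {n} → Vec ℤ n → Set
Signed {n} σ = All (InRange n) (abs σ) × Unique (abs σ)

evenNeg : ∀ {n} → Vec ℤ n → Bool
evenNeg σ = even (negCount σ)

lookup-abs-∈ : ∀ {n} (σ : Vec ℤ n) p → ∣ lookup σ p ∣ ∈ abs σ
lookup-abs-∈ (x ∷ σ) zero    = here refl
lookup-abs-∈ (x ∷ σ) (suc p) = there (lookup-abs-∈ σ p)

abs-injective : ∀ {n} (σ : Vec ℤ n) → Unique (abs σ) → ∀ {p p′} → ∣ lookup σ p ∣ ≡ ∣ lookup σ p′ ∣ → p ≡ p′
abs-injective (x ∷ σ) (x∉ ∷ σ!) {zero}  {zero}   e = refl
abs-injective (x ∷ σ) (x∉ ∷ σ!) {zero}  {suc p′} e = contradiction e (All.lookup x∉ (lookup-abs-∈ σ p′))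
abs-injective (x ∷ σ) (x∉ ∷ σ!) {suc p} {zero}   e = contradiction (sym e) (All.lookup x∉ (lookup-abs-∈ σ p))
abs-injective (x ∷ σ) (x∉ ∷ σ!) {suc p} {suc p′} e = cong suc (abs-injective σ σ! e)

-- Otherwise the `suc m` distinct absolute values, lowered by one, would all fit into `Fin m`.
largest-letter : ∀ {m} {σ : Vec ℤ (suc m)} → Signed σ → ∃₂ λ s p → lookup σ p ≡ letter s m
largest-letter {m} {σ} (rng , σ!) with FinP.any? (λ p → ∣ lookup σ p ∣ ℕ.≟ suc m)
... | yes (p , e) = let s , e′ = letter-surjective _ e in s , p , e′
... | no ¬max = ⊥-elim (collision (FinP.pigeonhole (ℕP.n<1+n m) slot))
  where
  bound : ∀ p → InRange (suc m) ∣ lookup σ p ∣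
  bound p = All.lookup rng (lookup-abs-∈ σ p)
  small : ∀ p → ℕ.pred ∣ lookup σ p ∣ < m
  small p with ∣ lookup σ p ∣ in eq | bound p
  ... | suc a | _ , s≤s a≤m = ℕP.≤∧≢⇒< a≤m λ a≡m → ¬max (p , ≡-trans eq (cong suc a≡m))
  slot : Fin (suc m) → Fin m
  slot p = fromℕ< (small p)
  pred-injective : ∀ {a b} → 1 ≤ a → 1 ≤ b → ℕ.pred a ≡ ℕ.pred b → a ≡ b
  pred-injective (s≤s _) (s≤s _) refl = refl
  collision : ¬ (∃₂ λ i j → i Fin.< j × slot i ≡ slot j)
  collision (i , j , i<j , e) = FinP.<⇒≢ i<j (abs-injective σ σ! (pred-injective (proj₁ (bound i)) (proj₁ (bound j))
    (FinP.fromℕ<-injective _ _ (small i) (small j) e)))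

-- Growth may move letters and change their signs, but the multiset of absolute values only gains m
-- + 1, and signedness depends on nothing else.
Signed-grow : ∀ {m} {σ : Vec ℤ m} {τ : Vec ℤ (suc m)} → abs τ ↭ suc m ∷ abs σ → Signed σ → Signed τ
Signed-grow {m} p (rng , σ!) =
  ↭P.All-resp-↭ (↭-sym p) ((s≤s z≤n , ℕP.≤-refl) ∷ All.map (λ (l , u) → l , ℕP.m≤n⇒m≤1+n u) rng) ,
  Unique-resp-↭ (↭-sym p) (All.map (λ (l , u) e → ℕP.<-irrefl refl (subst (_≤ m) (sym e) u)) rng ∷ σ!)

Signed-shrink : ∀ {m} {σ : Vec ℤ m} {τ : Vec ℤ (suc m)} → abs τ ↭ suc m ∷ abs σ → Signed τ → Signed σ
Signed-shrink {m} p (rng , τ!) with ↭P.All-resp-↭ p rng | Unique-resp-↭ p τ!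
... | _ ∷ rng′ | m∉ ∷ σ! =
  All.zipWith (λ ((l , u) , m≢) → l , ℕP.≤-pred (ℕP.≤∧≢⇒< u (m≢ ∘ sym))) (rng′ , m∉) , σ!

∈-points⁺ : ∀ {n x} → InRange n ∣ x ∣ → x ∈ points n
∈-points⁺ {n} {+ zero}   (() , _)
∈-points⁺ {n} {+ suc k}  (_ , k<n) = ∈P.∈-++⁺ʳ (map _ (upTo n)) (∈P.∈-map⁺ _ (∈P.∈-upTo⁺ k<n))
∈-points⁺ {n} { -[1+ k ]} (_ , k<n) = ∈P.∈-++⁺ˡ (∈P.∈-map⁺ _ (∈P.∈-upTo⁺ k<n))

∈-points⁻ : ∀ {n x} → x ∈ points n → InRange n ∣ x ∣
∈-points⁻ {n} x∈ with ∈P.∈-++⁻ (map (λ k → -[1+ k ]) (upTo n)) x∈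
... | inj₁ x∈ˡ with ∈P.∈-map⁻ (λ k → -[1+ k ]) x∈ˡ
...   | k , k∈ , refl = s≤s z≤n , ∈P.∈-upTo⁻ k∈
∈-points⁻ {n} x∈ | inj₂ x∈ʳ with ∈P.∈-map⁻ (λ k → + suc k) x∈ʳ
...   | k , k∈ , refl = s≤s z≤n , ∈P.∈-upTo⁻ k∈

points! : ∀ n → Unique (points n)
points! n = UniqueP.++⁺ (UniqueP.map⁺ (λ { refl → refl }) (UniqueP.upTo⁺ n)) (UniqueP.map⁺ (λ { refl → refl }) (UniqueP.upTo⁺ n))
  λ (x∈ , x∈′) → disjoint x∈ x∈′
  where
  disjoint : ∀ {x} → x ∈ map (λ k → -[1+ k ]) (upTo n) → ¬ (x ∈ map (λ k → + suc k) (upTo n))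
  disjoint x∈ x∈′ with ∈P.∈-map⁻ (λ k → -[1+ k ]) x∈ | ∈P.∈-map⁻ (λ k → + suc k) x∈′
  ... | _ , _ , refl | _ , _ , ()

∈-allVecs⁺ : ∀ {A : Set} {xs : List A} {n} {σ : Vec A n} → All (_∈ xs) (toList σ) → σ ∈ allVecs xs n
∈-allVecs⁺ {σ = []}    []         = here refl
∈-allVecs⁺ {xs = xs} {suc n} {σ = x ∷ σ} (x∈ ∷ σ∈) =
  ∈-concatMap⁺ (λ x → map (x ∷_) (allVecs xs n)) x∈ (∈P.∈-map⁺ (x ∷_) (∈-allVecs⁺ σ∈))

∈-allVecs⁻ : ∀ {A : Set} {xs : List A} {n} {σ : Vec A n} → σ ∈ allVecs xs n → All (_∈ xs) (toList σ)
∈-allVecs⁻ {n = zero}  {[]} _ = []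
∈-allVecs⁻ {xs = xs} {suc n} σ∈ with ∈-concatMap⁻ (λ x → map (x ∷_) (allVecs xs n)) xs σ∈
... | x , x∈ , σ∈′ with ∈P.∈-map⁻ (x ∷_) σ∈′
... | τ , τ∈ , refl = x∈ ∷ ∈-allVecs⁻ τ∈

allVecs-cartesian : ∀ {A : Set} (xs : List A) n ys → concatMap (λ x → map (x ∷_) (allVecs xs n)) ys ≡ cartesianProductWith _∷_ ys (allVecs xs n)
allVecs-cartesian xs n []       = refl
allVecs-cartesian xs n (y ∷ ys) = cong (map (y ∷_) (allVecs xs n) ++_) (allVecs-cartesian xs n ys)

allVecs! : ∀ {A : Set} {xs : List A} → Unique xs → ∀ n → Unique (allVecs xs n)
allVecs! xs! zero = [] ∷ []
allVecs! {xs = xs} xs! (suc n) = subst Unique (sym (allVecs-cartesian xs n xs))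
  (UniqueP.cartesianProductWith⁺ _∷_ VecP.∷-injective xs! (allVecs! xs! n))

distinctAbs⁺ : ∀ {xs} → Unique (map ∣_∣ xs) → T (distinctAbs xs)
distinctAbs⁺ {[]}     []         = _
distinctAbs⁺ {x ∷ xs} (x∉ ∷ xs!) with any (λ y → ⌊ ∣ x ∣ ℕ.≟ ∣ y ∣ ⌋) xs in eq
... | false = distinctAbs⁺ xs!
... | true with find (AnyP.any⁻ (λ y → ⌊ ∣ x ∣ ℕ.≟ ∣ y ∣ ⌋) xs (Equivalence.from T-≡ eq))
...   | y , y∈ , e = contradiction (toWitness e) (All.lookup x∉ (∈P.∈-map⁺ ∣_∣ y∈))

distinctAbs⁻ : ∀ {xs} → T (distinctAbs xs) → Unique (map ∣_∣ xs)
distinctAbs⁻ {[]}     _ = []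
distinctAbs⁻ {x ∷ xs} d with any (λ y → ⌊ ∣ x ∣ ℕ.≟ ∣ y ∣ ⌋) xs in eq
... | false = AllP.map⁺ (All.tabulate (λ {y} y∈ e → subst T eq (AnyP.any⁺ (λ y → ⌊ ∣ x ∣ ℕ.≟ ∣ y ∣ ⌋) (lose y∈ (fromWitness e))))) ∷ distinctAbs⁻ d

∈-Dlist⁺ : ∀ {n} {σ : Vec ℤ n} → Signed σ → T (evenNeg σ) → σ ∈ Dlist n
∈-Dlist⁺ (rng , σ!) ev = ∈-filterᵇ⁺ isD (∈-allVecs⁺ (All.map ∈-points⁺ (AllP.map⁻ rng)))
  (Equivalence.from T-∧ (distinctAbs⁺ σ! , ev))

∈-Dlist⁻ : ∀ {n} {σ : Vec ℤ n} → σ ∈ Dlist n → Signed σ × T (evenNeg σ)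
∈-Dlist⁻ {n} σ∈ with ∈-filterᵇ⁻ isD {xs = allVecs (points n) n} σ∈
... | σ∈′ , d with Equivalence.to T-∧ d
... | d′ , ev = (AllP.map⁺ (All.map ∈-points⁻ (∈-allVecs⁻ σ∈′)) , distinctAbs⁻ d′) , ev

-- Growing signed permutations by their largest letter

-- What the enumeration of D_n uses of a growth rule, so that insertion and multiplication by a
-- reflection share one argument. That `flips` depends on the choice and not on σ is what keeps
-- words of opposite parity opposite. `evenNeg-step` asks for signedness because negating an entry 0
-- would not change a sign.
record Scheme : Set where
  field
    step        : ∀ {m} → Choice m → Vec ℤ m → Vec ℤ (suc m)
    unstep      : ∀ {m} → Choice m → Vec ℤ (suc m) → Vec ℤ m
    flips       : ∀ {m} → Choice m → Bool
    abs-step    : ∀ {m} c (σ : Vec ℤ m) → abs (step c σ) ↭ suc m ∷ abs σ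
    lookup-step : ∀ {m} s p (σ : Vec ℤ m) → lookup (step (s , p) σ) p ≡ letter s m
    unstep-step : ∀ {m} c (σ : Vec ℤ m) → unstep c (step c σ) ≡ σ
    step-unstep : ∀ {m} s p (τ : Vec ℤ (suc m)) → lookup τ p ≡ letter s m → step (s , p) (unstep (s , p) τ) ≡ τ
    evenNeg-step : ∀ {m} c {σ : Vec ℤ m} → Signed σ → evenNeg (step c σ) ≡ flips c xor evenNeg σ

module Growth (S : Scheme) where
  open Scheme S

  -- The monomial is an index of the growth history; that σ determines it is `Built-functional`.
  data Built : ∀ n → Vec ℤ n → ℕ × ℕ → Set where
    empty : Built 0 [] (0 , 0)
    grow  : ∀ {m σ w} c → Built m σ w → Built (suc m) (step c σ) (w ⊕ weight c)

  Built⇒Signed : ∀ {n σ w} → Built n σ w → Signed σ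
  Built⇒Signed empty              = [] , []
  Built⇒Signed (grow {σ = σ} c b) = Signed-grow (abs-step c σ) (Built⇒Signed b)

  step-surjective : ∀ {m} {τ : Vec ℤ (suc m)} → Signed τ → ∃₂ λ c σ → τ ≡ step c σ × Signed σ
  step-surjective {m} {τ} τ-signed with largest-letter τ-signed
  ... | s , p , e = (s , p) , unstep (s , p) τ , sym e′ ,
    Signed-shrink (subst (λ τ → abs τ ↭ suc m ∷ _) e′ (abs-step (s , p) (unstep (s , p) τ))) τ-signed
    where
    e′ : step (s , p) (unstep (s , p) τ) ≡ τ
    e′ = step-unstep s p τ e

  -- The only entry of absolute value m + 1 reveals the position, its sign reveals s, and `unstep`
  -- then recovers σ.
  step-injective : ∀ {m} {σ σ′ : Vec ℤ m} {c c′} → Signed σ → step c σ ≡ step c′ σ′ → σ ≡ σ′ × c ≡ c′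
  step-injective {m} {σ} {σ′} {s , p} {s′ , p′} σ-signed e with
    abs-injective (step (s , p) σ) (proj₂ (Signed-grow (abs-step _ σ) σ-signed)) {p} {p′} same-abs
    where
    same-abs : ∣ lookup (step (s , p) σ) p ∣ ≡ ∣ lookup (step (s , p) σ) p′ ∣
    same-abs = begin
      ∣ lookup (step (s , p) σ) p ∣    ≡⟨ cong ∣_∣ (lookup-step s p σ) ⟩
      ∣ letter s m ∣                   ≡⟨ ∣letter∣ s m ⟩
      suc m                            ≡⟨ ∣letter∣ s′ m ⟨
      ∣ letter s′ m ∣                  ≡⟨ cong ∣_∣ (lookup-step s′ p′ σ′) ⟨
      ∣ lookup (step (s′ , p′) σ′) p′ ∣ ≡⟨ cong (λ τ → ∣ lookup τ p′ ∣) e ⟨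
      ∣ lookup (step (s , p) σ) p′ ∣   ∎
      where open ≡-Reasoning
  ... | refl with letter-injective {s} {s′} (≡-trans (sym (lookup-step s p σ)) (≡-trans (cong (λ τ → lookup τ p) e) (lookup-step s′ p σ′)))
  ... | refl , _ = ≡-trans (sym (unstep-step (s , p) σ)) (≡-trans (cong (unstep (s , p)) e) (unstep-step (s , p) σ′)) , refl

  Built-total : ∀ {n} {σ : Vec ℤ n} → Signed σ → ∃ (Built n σ)
  Built-total {zero} {[]} _ = _ , empty
  Built-total {suc m} τ-signed with step-surjective τ-signed
  ... | c , σ , refl , σ-signed = _ , grow c (proj₂ (Built-total σ-signed))

  Built-functional : ∀ {n σ w w′} → Built n σ w → Built n σ w′ → w ≡ w′
  Built-functional b b′ = go b b′ refl
    where
    -- Two histories of the same word would have to be unified at `step c σ` and `step c′ σ′`, so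
    -- the equation between the words is kept as an argument.
    go : ∀ {n σ σ′ w w′} → Built n σ w → Built n σ′ w′ → σ ≡ σ′ → w ≡ w′
    go empty      empty        _ = refl
    go (grow c b) (grow c′ b′) e with step-injective (Built⇒Signed b) e
    ... | refl , refl = cong (_⊕ weight c) (go b b′ refl)

  -- Enumeration by the initial sign of the letter 1

  Weighted : ℕ → Set
  Weighted n = Vec ℤ n × ℕ × ℕ

  extend : ∀ {m} → Weighted m → Choice m → Weighted (suc m)
  extend (σ , w) c = step c σ , w ⊕ weight c

  -- Here `s` is the sign with which the letter 1 enters; under sorting, later steps may change the
  -- sign that it shows.
  words : Sign → ∀ m → List (Weighted (suc m))
  words s zero    = (letter s 0 ∷ [] , 0 , 0) ∷ []
  words s (suc m) = cartesianProductWith extend (words s m) (choices (suc m))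

  -- For an abstract scheme only `lookup-step` describes the new word, and a vector of length 1 is
  -- determined by its entry.
  step-[] : ∀ s → step (s , zero) [] ≡ letter s 0 ∷ []
  step-[] s with step (s , zero) [] | lookup-step s zero []
  ... | x ∷ [] | refl = refl

  words-built : ∀ s m → All (λ (σ , w) → Built (suc m) σ w) (words s m)
  words-built Sign.+ zero = subst (λ σ → Built 1 σ (0 , 0)) (step-[] Sign.+) (grow (Sign.+ , zero) empty) ∷ []
  words-built Sign.- zero = subst (λ σ → Built 1 σ (0 , 0)) (step-[] Sign.-) (grow (Sign.- , zero) empty) ∷ []
  words-built s (suc m)   = All-cartesianProductWith extend grow (choices (suc m)) (words-built s m)

  words-total : ∀ m {σ : Vec ℤ (suc m)} → Signed σ → ∃₂ λ s w → (σ , w) ∈ words s m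
  words-total zero σ-signed with step-surjective σ-signed
  ... | (s , zero) , [] , refl , _ = s , _ , here (cong (_, (0 , 0)) (step-[] s))
  words-total (suc m) τ-signed with step-surjective τ-signed
  ... | c , σ , refl , σ-signed with words-total m σ-signed
  ... | s , w , ∈words = s , _ , ∈P.∈-cartesianProductWith⁺ extend ∈words (choices-complete c)

  allWords± : ∀ m → List (Weighted (suc m))
  allWords± m = words Sign.+ m ++ words Sign.- m

  allWords±-built : ∀ m → All (λ (σ , w) → Built (suc m) σ w) (allWords± m)
  allWords±-built m = AllP.++⁺ (words-built Sign.+ m) (words-built Sign.- m)

  allWords±! : ∀ m → AllPairs (_≢_ on proj₁) (allWords± m)
  allWords±! zero    = ((λ ()) ∷ []) ∷ [] ∷ []
  allWords±! (suc m) = subst (AllPairs _)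
    (ListP.cartesianProductWith-distribʳ-++ extend (words Sign.+ m) (words Sign.- m) (choices (suc m)))
    (AllPairs-cartesianProductWith extend proj₁ proj₁ (Signed ∘ proj₁) (λ σ-signed _ → step-injective σ-signed)
      (All.map Built⇒Signed (allWords±-built m)) (allWords±! m) (choices! (suc m)))

  Opposite : ∀ {n} → Weighted n → Weighted n → Set
  Opposite {n} (σ , w) (τ , w′) = Built n σ w × Built n τ w′ × w ≡ w′ × evenNeg σ ≡ not (evenNeg τ)

  -- The words 1 and -1 have opposite parities, and a common choice flips both parities or neither.
  words-opposite : ∀ m → Pointwise Opposite (words Sign.+ m) (words Sign.- m)
  words-opposite zero with words-built Sign.+ zero | words-built Sign.- zero
  ... | b ∷ [] | b′ ∷ [] = (b , b′ , refl , refl) ∷ []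
  words-opposite (suc m) = Pointwise-cartesianProductWith extend opposite (choices (suc m)) (words-opposite m)
    where
    xor-not : ∀ x y → x xor not y ≡ not (x xor y)
    xor-not true  y = refl
    xor-not false y = refl
    opposite : ∀ {x x′ : Weighted (suc m)} c → Opposite x x′ → Opposite (extend x c) (extend x′ c)
    opposite {σ , w} {τ , w′} c (b , b′ , refl , e) = grow c b , grow c b′ , refl , (begin
      evenNeg (step c σ)            ≡⟨ evenNeg-step c (Built⇒Signed b) ⟩
      flips c xor evenNeg σ         ≡⟨ cong (flips c xor_) e ⟩
      flips c xor not (evenNeg τ)   ≡⟨ xor-not (flips c) (evenNeg τ) ⟩
      not (flips c xor evenNeg τ)   ≡⟨ cong not (evenNeg-step c (Built⇒Signed b′)) ⟨
      not (evenNeg (step c τ))      ∎)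
      where open ≡-Reasoning

  -- The two orders of enumeration are not compared: both lists are free of repetitions and have the
  -- same members.
  Dlist-↭ : ∀ m → Dlist (suc m) ↭ filterᵇ evenNeg (map proj₁ (allWords± m))
  Dlist-↭ m = unique-set⇒↭ (UniqueP.filter⁺ _ (allVecs! (points! (suc m)) (suc m)))
    (UniqueP.filter⁺ _ (AllPairsP.map⁺ (allWords±! m))) to from
    where
    to : ∀ {σ} → σ ∈ Dlist (suc m) → σ ∈ filterᵇ evenNeg (map proj₁ (allWords± m))
    to σ∈ with ∈-Dlist⁻ σ∈
    ... | σ-signed , ev with words-total m σ-signed
    ... | Sign.+ , w , ∈words = ∈-filterᵇ⁺ evenNeg (∈P.∈-map⁺ proj₁ (∈P.∈-++⁺ˡ ∈words)) ev
    ... | Sign.- , w , ∈words = ∈-filterᵇ⁺ evenNeg (∈P.∈-map⁺ proj₁ (∈P.∈-++⁺ʳ (words Sign.+ m) ∈words)) ev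
    from : ∀ {σ} → σ ∈ filterᵇ evenNeg (map proj₁ (allWords± m)) → σ ∈ Dlist (suc m)
    from σ∈ with ∈-filterᵇ⁻ evenNeg {xs = map proj₁ (allWords± m)} σ∈
    ... | σ∈′ , ev with ∈P.∈-map⁻ proj₁ σ∈′
    ... | _ , ∈words , refl = ∈-Dlist⁺ (Built⇒Signed (All.lookup (allWords±-built m) ∈words)) ev

  -- Each opposite pair keeps exactly one member under the filter, and since both members have the
  -- same monomial it does not matter which one is kept.
  filter-opposite : ∀ {n} (stat : Vec ℤ n → ℕ × ℕ) → (∀ {σ w} → Built n σ w → T (evenNeg σ) → stat σ ≡ w) →
    ∀ {xs ys} → Pointwise Opposite xs ys →
    map stat (filterᵇ evenNeg (map proj₁ xs)) ++ map stat (filterᵇ evenNeg (map proj₁ ys)) ↭ map proj₂ xs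
  filter-opposite stat correct [] = ↭-refl
  filter-opposite stat correct {(σ , w) ∷ xs} {(τ , _) ∷ ys} ((b , b′ , refl , e) ∷ opp)
    with evenNeg σ in eqσ | evenNeg τ in eqτ
  ... | true | false = ↭-trans (↭-prep _ (filter-opposite stat correct opp))
    (↭-reflexive (cong (_∷ _) (correct b (Equivalence.from T-≡ eqσ))))
  ... | false | true = ↭-trans (↭P.shift _ (map stat (filterᵇ evenNeg (map proj₁ xs))) _)
    (↭-trans (↭-prep _ (filter-opposite stat correct opp))
             (↭-reflexive (cong (_∷ _) (correct b′ (Equivalence.from T-≡ eqτ)))))

  weights-words : ∀ m → map proj₂ (words Sign.+ m) ↭ prodPoly (suc m)
  weights-words zero    = ↭-refl
  weights-words (suc m) = begin
    map proj₂ (cartesianProductWith extend (words Sign.+ m) (choices (suc m)))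
      ≡⟨ weights-extend (words Sign.+ m) (choices (suc m)) ⟩
    cartesianProductWith _⊕_ (map proj₂ (words Sign.+ m)) (map weight (choices (suc m)))
      ↭⟨ cartesianProductWith-↭ _⊕_ (map proj₂ (words Sign.+ m)) (weights-choices m) ⟩
    cartesianProductWith _⊕_ (map proj₂ (words Sign.+ m)) (factor (suc m))
      ↭⟨ cartesianProductWith-↭ˡ _⊕_ (factor (suc m)) (weights-words m) ⟩
    cartesianProductWith _⊕_ (prodPoly (suc m)) (factor (suc m))
      ≡⟨ polyMul-cartesian (prodPoly (suc m)) (factor (suc m)) ⟨
    polyMul (prodPoly (suc m)) (factor (suc m))
      ≡⟨ prodPoly-suc m ⟨
    prodPoly (suc (suc m))
      ∎
    where
    open PermutationReasoning
    weights-extend : ∀ {n} (xs : List (Weighted n)) cs →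
      map proj₂ (cartesianProductWith extend xs cs) ≡ cartesianProductWith _⊕_ (map proj₂ xs) (map weight cs)
    weights-extend []       cs = refl
    weights-extend (x ∷ xs) cs = ≡-trans (ListP.map-++ proj₂ (map (extend x) cs) _)
      (cong₂ _++_ (≡-trans (sym (ListP.map-∘ cs)) (ListP.map-∘ cs)) (weights-extend xs cs))

  -- `correct` speaks of even words only, since `lD'` is a word length only on D_n: the elements of
  -- T^D generate no odd word.
  genFun-↭-prodPoly : ∀ m (f g : Vec ℤ (suc m) → ℕ) →
    (∀ {σ w} → Built (suc m) σ w → T (evenNeg σ) → (f σ , g σ) ≡ w) → genFun (suc m) f g ↭ prodPoly (suc m)
  genFun-↭-prodPoly m f g correct = begin
    map stat (Dlist (suc m))
      ↭⟨ ↭P.map⁺ stat (Dlist-↭ m) ⟩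
    map stat (filterᵇ evenNeg (map proj₁ (allWords± m)))
      ≡⟨ cong (map stat ∘ filterᵇ evenNeg) (ListP.map-++ proj₁ (words Sign.+ m) (words Sign.- m)) ⟩
    map stat (filterᵇ evenNeg (map proj₁ (words Sign.+ m) ++ map proj₁ (words Sign.- m)))
      ≡⟨ cong (map stat) (ListP.filter-++ _ (map proj₁ (words Sign.+ m)) (map proj₁ (words Sign.- m))) ⟩
    map stat (filterᵇ evenNeg (map proj₁ (words Sign.+ m)) ++ filterᵇ evenNeg (map proj₁ (words Sign.- m)))
      ≡⟨ ListP.map-++ stat (filterᵇ evenNeg (map proj₁ (words Sign.+ m))) _ ⟩
    map stat (filterᵇ evenNeg (map proj₁ (words Sign.+ m))) ++ map stat (filterᵇ evenNeg (map proj₁ (words Sign.- m)))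
      ↭⟨ filter-opposite stat correct (words-opposite m) ⟩
    map proj₂ (words Sign.+ m)
      ↭⟨ weights-words m ⟩
    prodPoly (suc m)
      ∎
    where
    open PermutationReasoning
    stat : Vec ℤ (suc m) → ℕ × ℕ
    stat σ = f σ , g σ

-- Inversions

count-++ : ∀ {A : Set} (p : A → Bool) xs ys → count p (xs ++ ys) ≡ count p xs + count p ys
count-++ p xs ys = ≡-trans (cong length (ListP.filter-++ (T? ∘ p) xs ys)) (ListP.length-++ (filterᵇ p xs))

count-map : ∀ {A B : Set} (p : B → Bool) (f : A → B) xs → count p (map f xs) ≡ count (p ∘ f) xs
count-map p f []       = refl
count-map p f (x ∷ xs) with p (f x)
... | true  = cong suc (count-map p f xs)
... | false = count-map p f xs

count-↭ : ∀ {A : Set} (p : A → Bool) {xs ys} → xs ↭ ys → count p xs ≡ count p ys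
count-↭ p xs↭ys = ↭P.↭-length (↭P.filter-↭ (T? ∘ p) xs↭ys)

count-all : ∀ {A : Set} (p : A → Bool) {xs} → All (T ∘ p) xs → count p xs ≡ length xs
count-all p pxs = cong length (ListP.filter-all (T? ∘ p) pxs)

count-none : ∀ {A : Set} (p : A → Bool) {xs} → All (¬_ ∘ T ∘ p) xs → count p xs ≡ 0
count-none p ¬pxs = cong length (ListP.filter-none (T? ∘ p) ¬pxs)

count-∷-true : ∀ {A : Set} (p : A → Bool) {x} xs → T (p x) → count p (x ∷ xs) ≡ suc (count p xs)
count-∷-true p {x} xs px with p x
... | true = refl

count-∷-false : ∀ {A : Set} (p : A → Bool) {x} xs → ¬ T (p x) → count p (x ∷ xs) ≡ count p xs
count-∷-false p {x} xs ¬px with p x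
... | false = refl
... | true  = contradiction _ ¬px

even-suc : ∀ n → even (suc n) ≡ not (even n)
even-suc zero          = refl
even-suc (suc zero)    = refl
even-suc (suc (suc n)) = even-suc n

toList-insertAt-↭ : ∀ {n} (σ : Vec ℤ n) p v → toList (Vec.insertAt σ p v) ↭ v ∷ toList σ
toList-insertAt-↭ σ       zero    v = ↭-refl
toList-insertAt-↭ (x ∷ σ) (suc p) v = ↭-trans (↭-prep x (toList-insertAt-↭ σ p v)) (↭-swap x v ↭-refl)

isNegative : Sign → Bool
isNegative Sign.+ = false
isNegative Sign.- = true

insertion : Scheme
insertion = record
  { step         = λ { {m} (s , p) σ → Vec.insertAt σ p (letter s m) }
  ; unstep       = λ (s , p) τ → Vec.removeAt τ p
  ; flips        = λ (s , p) → isNegative s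
  ; abs-step     = λ { {m} (s , p) σ → ↭-trans (↭P.map⁺ ∣_∣ (toList-insertAt-↭ σ p (letter s m)))
                                          (↭-reflexive (cong (_∷ abs σ) (∣letter∣ s m))) }
  ; lookup-step  = λ s p σ → VecP.insertAt-lookup σ p _
  ; unstep-step  = λ (s , p) σ → VecP.removeAt-insertAt σ p _
  ; step-unstep  = λ s p τ e → ≡-trans (cong (Vec.insertAt (Vec.removeAt τ p) p) (sym e)) (VecP.insertAt-removeAt τ p)
  ; evenNeg-step = λ { {m} (s , p) {σ} _ → evenNeg-insertAt s p σ m }
  }
  where
  evenNeg-insertAt : ∀ {n} s p (σ : Vec ℤ n) m → evenNeg (Vec.insertAt σ p (letter s m)) ≡ isNegative s xor evenNeg σ
  evenNeg-insertAt s p σ m rewrite count-↭ (_<ᶻ + 0) (toList-insertAt-↭ σ p (letter s m)) with s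
  ... | Sign.+ = refl
  ... | Sign.- = even-suc (negCount σ)

open module Insertion = Growth insertion using () renaming (Built to Inserted)

-- The share in inv_D of the pairs whose first entry is x, when `ys` are the entries after it.
below : ℤ → List ℤ → ℕ
below x ys = count (_<ᶻ x) ys + count (_<ᶻ ℤ.- x) ys

count-pairs : ∀ (p : ℤ × ℤ → Bool) x xs → count p (pairsL (x ∷ xs)) ≡ count (λ y → p (x , y)) xs + count p (pairsL xs)
count-pairs p x xs = ≡-trans (count-++ p (map (x ,_) xs) (pairsL xs)) (cong (_+ count p (pairsL xs)) (count-map p (x ,_) xs))

invD-∷ : ∀ {n} x (σ : Vec ℤ n) → invD (x ∷ σ) ≡ below x (toList σ) + invD σ
invD-∷ x σ = ≡-trans (cong₂ _+_ (count-pairs _ x (toList σ)) (count-pairs _ x (toList σ)))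
  (interchange (count (_<ᶻ x) (toList σ)) _ (count (_<ᶻ ℤ.- x) (toList σ)) _)

Bounded : ℕ → ∀ {n} → Vec ℤ n → Set
Bounded N σ = All (λ x → ∣ x ∣ ≤ N) (toList σ)

-[1+n]<x : ∀ {N x} → ∣ x ∣ ≤ N → -[1+ N ] ℤ.< x
-[1+n]<x {x = + a}       _   = ℤ.-<+
-[1+n]<x {x = -[1+ a ]} a<N = ℤ.-<- a<N

x<1+n : ∀ {N x} → ∣ x ∣ ≤ N → x ℤ.< + suc N
x<1+n {x = + a}       a≤N = ℤ.+<+ (s≤s a≤N)
x<1+n {x = -[1+ a ]} _   = ℤ.-<+

∣-x∣≤ : ∀ {N} x → ∣ x ∣ ≤ N → ∣ ℤ.- x ∣ ≤ N
∣-x∣≤ {N} x = subst (_≤ N) (sym (ℤP.∣-i∣≡∣i∣ x))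

-- Of the letter and its negative, one exceeds every other entry and the other exceeds none, so each
-- later entry is counted exactly once.
below-letter : ∀ N s ys → All (λ y → ∣ y ∣ ≤ N) ys → below (letter s N) ys ≡ length ys
below-letter N Sign.+ ys bd = ≡-trans
  (cong₂ _+_ (count-all (_<ᶻ + suc N) (All.map (fromWitness ∘ x<1+n) bd))
             (count-none (_<ᶻ -[1+ N ]) (All.map (λ b t → ℤP.<-asym (-[1+n]<x b) (toWitness t)) bd)))
  (ℕP.+-identityʳ (length ys))
below-letter N Sign.- ys bd =
  cong₂ _+_ (count-none (_<ᶻ -[1+ N ]) (All.map (λ b t → ℤP.<-asym (-[1+n]<x b) (toWitness t)) bd))
            (count-all (_<ᶻ + suc N) (All.map (fromWitness ∘ x<1+n) bd))

-- An entry x standing before the new letter gains this much: -(N + 1) is smaller than both x and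
-- -x, and N + 1 is smaller than neither.
excess : Sign → ℕ
excess Sign.+ = 0
excess Sign.- = 2

below-∷letter : ∀ N s {x} ys → ∣ x ∣ ≤ N → below x (letter s N ∷ ys) ≡ excess s + below x ys
below-∷letter N Sign.+ {x} ys x≤N = cong₂ _+_
  (count-∷-false (_<ᶻ x) {+ suc N} ys λ t → ℤP.<-asym (x<1+n {x = x} x≤N) (toWitness t))
  (count-∷-false (_<ᶻ ℤ.- x) {+ suc N} ys λ t → ℤP.<-asym (x<1+n {x = ℤ.- x} (∣-x∣≤ x x≤N)) (toWitness t))
below-∷letter N Sign.- {x} ys x≤N = ≡-trans (cong₂ _+_
  (count-∷-true (_<ᶻ x) { -[1+ N ]} ys (fromWitness (-[1+n]<x {x = x} x≤N)))
  (count-∷-true (_<ᶻ ℤ.- x) { -[1+ N ]} ys (fromWitness (-[1+n]<x {x = ℤ.- x} (∣-x∣≤ x x≤N)))))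
  (cong suc (ℕP.+-suc (count (_<ᶻ x) ys) _))

degree-suc : ∀ {k} s (p : Fin (suc k)) → degree (suc k) (s , suc p) ≡ excess s + degree k (s , p)
degree-suc Sign.+ p = refl
degree-suc {k} Sign.- p = cong suc (ℕP.+-suc k (toℕ p))

degree-zero : ∀ {k} s → degree k (s , zero) ≡ k
degree-zero Sign.+ = refl
degree-zero {k} Sign.- = ℕP.+-identityʳ k

below-↭ : ∀ x {ys zs} → ys ↭ zs → below x ys ≡ below x zs
below-↭ x p = cong₂ _+_ (count-↭ (_<ᶻ x) p) (count-↭ (_<ᶻ ℤ.- x) p)

-- The k - p entries after the letter contribute one each and the p entries before it contribute
-- `excess s` each, which makes k - p or k + p in total. The size `N` is independent of the length
-- `k` because the induction strips entries from the front while the letter stays the same.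
invD-insertAt : ∀ N s {k} (σ : Vec ℤ k) p → Bounded N σ →
  invD (Vec.insertAt σ p (letter s N)) ≡ invD σ + degree k (s , p)
invD-insertAt N s {k} σ zero bd = begin
  invD (letter s N ∷ σ)                      ≡⟨ invD-∷ (letter s N) σ ⟩
  below (letter s N) (toList σ) + invD σ     ≡⟨ cong (_+ invD σ) (below-letter N s (toList σ) bd) ⟩
  length (toList σ) + invD σ                 ≡⟨ cong (_+ invD σ) (VecP.length-toList σ) ⟩
  k + invD σ                                 ≡⟨ ℕP.+-comm k (invD σ) ⟩
  invD σ + k                                 ≡⟨ cong (_+_ (invD σ)) (degree-zero s) ⟨
  invD σ + degree k (s , zero)               ∎
  where open ≡-Reasoning
invD-insertAt N s {suc k} (x ∷ σ) (suc p) (x≤N ∷ bd) = begin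
  invD (x ∷ σ⁺)                              ≡⟨ invD-∷ x σ⁺ ⟩
  below x (toList σ⁺) + invD σ⁺              ≡⟨ cong₂ _+_ (≡-trans (below-↭ x (toList-insertAt-↭ σ p (letter s N))) (below-∷letter N s (toList σ) x≤N))
                                                          (invD-insertAt N s σ p bd) ⟩
  (excess s + b) + (invD σ + degree k (s , p))  ≡⟨ cong (_+ (invD σ + degree k (s , p))) (ℕP.+-comm (excess s) b) ⟩
  (b + excess s) + (invD σ + degree k (s , p))  ≡⟨ interchange b (excess s) (invD σ) _ ⟩
  (b + invD σ) + (excess s + degree k (s , p))  ≡⟨ cong₂ _+_ (invD-∷ x σ) (degree-suc s p) ⟨
  invD (x ∷ σ) + degree (suc k) (s , suc p)  ∎
  where
  open ≡-Reasoning
  σ⁺ : Vec ℤ (suc k)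
  σ⁺ = Vec.insertAt σ p (letter s N)
  b : ℕ
  b = below x (toList σ)

-- Signed right-to-left minima

any-insertAt : ∀ (q : ℤ → Bool) {k} (σ : Vec ℤ k) p {v} → q v ≡ false → any q (toList (Vec.insertAt σ p v)) ≡ any q (toList σ)
any-insertAt q σ       zero    e rewrite e = refl
any-insertAt q (x ∷ σ) (suc p) e with q x
... | true  = refl
... | false = any-insertAt q σ p e

⌊⌋-false : ∀ {A : Set} {a? : Dec A} → ¬ A → ⌊ a? ⌋ ≡ false
⌊⌋-false {a? = yes a} ¬a = contradiction a ¬a
⌊⌋-false {a? = no _}  _  = refl

any-<-negative : ∀ N ys → any (λ y → + ∣ y ∣ <ᶻ -[1+ N ]) ys ≡ false
any-<-negative N []       = refl
any-<-negative N (y ∷ ys) = any-<-negative N ys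

-- The share of the new letter in the first summand of nmin_D: a positive one counts as soon as some
-- entry follows it. A negative one is left to the second summand.
minima : ∀ {k} → Choice k → ℕ
minima {k} (Sign.+ , p) = 1 ⊓ (k ∸ toℕ p)
minima     (Sign.- , p) = 0

-- An earlier entry x counts when a later absolute value is smaller than x. The new letter never has
-- this effect, because N + 1 exceeds x, so only the letter itself adds something.
nminL-insertAt : ∀ N s {k} (σ : Vec ℤ k) p → Bounded N σ →
  nminL (toList (Vec.insertAt σ p (letter s N))) ≡ minima (s , p) + nminL (toList σ)
nminL-insertAt N Sign.+ []      zero _ = refl
nminL-insertAt N Sign.- []      zero _ = refl
nminL-insertAt N Sign.+ (x ∷ σ) zero (x≤N ∷ _)
  rewrite Equivalence.to T-≡ (fromWitness {a? = + ∣ x ∣ ℤ.<? + suc N} (ℤ.+<+ (s≤s x≤N))) = refl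
nminL-insertAt N Sign.- σ@(_ ∷ _) zero _ rewrite any-<-negative N (toList σ) = refl
nminL-insertAt N s (x ∷ σ) (suc p) (x≤N ∷ bd)
  rewrite any-insertAt (λ y → + ∣ y ∣ <ᶻ x) σ p {letter s N}
            (⌊⌋-false λ lt → ℤP.<-asym lt (subst (λ a → x ℤ.< + a) (sym (∣letter∣ s N)) (x<1+n x≤N)))
        | nminL-insertAt N s σ p bd = helper s _ (nminL (toList σ))
  where
  helper : ∀ s a b → a + (minima (s , p) + b) ≡ minima (s , suc p) + (a + b)
  helper Sign.+ a b = x∙yz≈y∙xz a (minima (Sign.+ , p)) b
  helper Sign.- a b = refl

nminD-insertAt : ∀ s {m} (σ : Vec ℤ m) p → Bounded m σ →
  nminD (Vec.insertAt σ p (letter s m)) ≡ nminD σ + 1 ⊓ degree m (s , p)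
nminD-insertAt s {m} σ p bd = begin
  nminL (toList σ⁺) + count negative (toList σ⁺)
    ≡⟨ cong₂ _+_ (nminL-insertAt m s σ p bd) (count-↭ negative (toList-insertAt-↭ σ p (letter s m))) ⟩
  (minima (s , p) + nminL (toList σ)) + count negative (letter s m ∷ toList σ)
    ≡⟨ cong (_+_ (minima (s , p) + nminL (toList σ))) (count-++ negative (letter s m ∷ []) (toList σ)) ⟩
  (minima (s , p) + nminL (toList σ)) + (count negative (letter s m ∷ []) + count negative (toList σ))
    ≡⟨ cong (_+ (count negative (letter s m ∷ []) + count negative (toList σ))) (ℕP.+-comm (minima (s , p)) _) ⟩
  (nminL (toList σ) + minima (s , p)) + (count negative (letter s m ∷ []) + count negative (toList σ))
    ≡⟨ cong (_+_ (nminL (toList σ) + minima (s , p))) (ℕP.+-comm _ (count negative (toList σ))) ⟩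
  (nminL (toList σ) + minima (s , p)) + (count negative (toList σ) + count negative (letter s m ∷ []))
    ≡⟨ interchange (nminL (toList σ)) _ _ _ ⟩
  nminD σ + (minima (s , p) + count negative (letter s m ∷ []))
    ≡⟨ cong (_+_ (nminD σ)) (total s m p) ⟩
  nminD σ + 1 ⊓ degree m (s , p)
    ∎
  where
  open ≡-Reasoning
  σ⁺ : Vec ℤ (suc m)
  σ⁺ = Vec.insertAt σ p (letter s m)
  negative : ℤ → Bool
  negative x = x <ᶻ -[1+ 0 ]
  total : ∀ s m (p : Fin (suc m)) → minima (s , p) + count negative (letter s m ∷ []) ≡ 1 ⊓ degree m (s , p)
  total Sign.+ m       p    = ℕP.+-identityʳ _
  -- The letter -1 is not smaller than -1, in agreement with its degree 0.
  total Sign.- zero    zero = refl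
  total Sign.- (suc m) p    = refl

Signed⇒Bounded : ∀ {m} {σ : Vec ℤ m} → Signed σ → Bounded m σ
Signed⇒Bounded (rng , _) = All.map proj₂ (AllP.map⁻ rng)

Inserted-stat : ∀ {n σ w} → Inserted n σ w → (invD σ , nminD σ) ≡ w
Inserted-stat Growth.empty = refl
Inserted-stat (Growth.grow {m} {σ} {w} (s , p) b) = ≡-trans
  (cong₂ _,_ (invD-insertAt m s σ p bd) (nminD-insertAt s σ p bd))
  (cong (_⊕ weight (s , p)) (Inserted-stat b))
  where
  bd : Bounded m σ
  bd = Signed⇒Bounded (Insertion.Built⇒Signed b)

-- Reflections

neg-fixed⇒0 : ∀ {a} → ℤ.- a ≡ a → a ≡ + 0
neg-fixed⇒0 {+ zero} _ = refl

neg-swap : ∀ {a b} → ℤ.- a ≡ b → ℤ.- b ≡ a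
neg-swap {a} refl = ℤP.neg-involutive a

reflMap-fst : ∀ a b → reflMap a b a ≡ b
reflMap-fst a b with a ℤ.≟ a
... | yes _  = refl
... | no a≢a = contradiction refl a≢a

reflMap-snd : ∀ a b → reflMap a b b ≡ a
reflMap-snd a b with b ℤ.≟ a
... | yes e = e
... | no _ with b ℤ.≟ b
...   | yes _  = refl
...   | no b≢b = contradiction refl b≢b

reflMap-neg-fst : ∀ {a} b → a ≢ + 0 → reflMap a b (ℤ.- a) ≡ ℤ.- b
reflMap-neg-fst {a} b a≢0 with ℤ.- a ℤ.≟ a
... | yes e = contradiction (neg-fixed⇒0 e) a≢0
... | no _ with ℤ.- a ℤ.≟ b
...   | yes e = sym (neg-swap e)
...   | no _ with ℤ.- a ℤ.≟ ℤ.- a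
...     | yes _  = refl
...     | no a≢a = contradiction refl a≢a

reflMap-neg-snd : ∀ a {b} → b ≢ + 0 → reflMap a b (ℤ.- b) ≡ ℤ.- a
reflMap-neg-snd a {b} b≢0 with ℤ.- b ℤ.≟ a
... | yes e = sym (neg-swap e)
... | no _ with ℤ.- b ℤ.≟ b
...   | yes e = contradiction (neg-fixed⇒0 e) b≢0
...   | no _ with ℤ.- b ℤ.≟ ℤ.- a
...     | yes e = e
...     | no _ with ℤ.- b ℤ.≟ ℤ.- b
...       | yes _  = refl
...       | no b≢b = contradiction refl b≢b

reflMap-fixes : ∀ {a b x} → x ≢ a → x ≢ b → x ≢ ℤ.- a → x ≢ ℤ.- b → reflMap a b x ≡ x
reflMap-fixes {a} {b} {x} x≢a x≢b x≢-a x≢-b with x ℤ.≟ a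
... | yes e = contradiction e x≢a
... | no _ with x ℤ.≟ b
...   | yes e = contradiction e x≢b
...   | no _ with x ℤ.≟ ℤ.- a
...     | yes e = contradiction e x≢-a
...     | no _ with x ℤ.≟ ℤ.- b
...       | yes e = contradiction e x≢-b
...       | no _  = refl

-- The moved points may coincide, as for a = -b, so the cases overlap; each of them only has to
-- supply one valid equation.
data Position (a b : ℤ) : ℤ → Set where
  at-fst  : Position a b a
  at-snd  : Position a b b
  at-fst⁻ : Position a b (ℤ.- a)
  at-snd⁻ : Position a b (ℤ.- b)
  apart   : ∀ {x} → x ≢ a → x ≢ b → x ≢ ℤ.- a → x ≢ ℤ.- b → Position a b x

position : ∀ a b x → Position a b x
position a b x with x ℤ.≟ a
... | yes refl = at-fst
... | no x≢a with x ℤ.≟ b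
...   | yes refl = at-snd
...   | no x≢b with x ℤ.≟ ℤ.- a
...     | yes refl = at-fst⁻
...     | no x≢-a with x ℤ.≟ ℤ.- b
...       | yes refl = at-snd⁻
...       | no x≢-b  = apart x≢a x≢b x≢-a x≢-b

neg-≢ : ∀ {x y} → x ≢ ℤ.- y → ℤ.- x ≢ y
neg-≢ {x} ≢ e = ≢ (sym (neg-swap e))

neg≢0 : ∀ {a} → a ≢ + 0 → ℤ.- a ≢ + 0
neg≢0 a≢0 e = a≢0 (sym (neg-swap e))

module _ {a b : ℤ} (a≢0 : a ≢ + 0) (b≢0 : b ≢ + 0) where

  reflMap-neg : ∀ x → reflMap a b (ℤ.- x) ≡ ℤ.- reflMap a b x
  reflMap-neg x with position a b x
  ... | at-fst  = ≡-trans (reflMap-neg-fst b a≢0) (cong ℤ.-_ (sym (reflMap-fst a b)))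
  ... | at-snd  = ≡-trans (reflMap-neg-snd a b≢0) (cong ℤ.-_ (sym (reflMap-snd a b)))
  ... | at-fst⁻ = begin
    reflMap a b (ℤ.- ℤ.- a)    ≡⟨ cong (reflMap a b) (ℤP.neg-involutive a) ⟩
    reflMap a b a              ≡⟨ reflMap-fst a b ⟩
    b                          ≡⟨ ℤP.neg-involutive b ⟨
    ℤ.- ℤ.- b                  ≡⟨ cong ℤ.-_ (reflMap-neg-fst b a≢0) ⟨
    ℤ.- reflMap a b (ℤ.- a)    ∎
    where open ≡-Reasoning
  ... | at-snd⁻ = begin
    reflMap a b (ℤ.- ℤ.- b)    ≡⟨ cong (reflMap a b) (ℤP.neg-involutive b) ⟩
    reflMap a b b              ≡⟨ reflMap-snd a b ⟩
    a                          ≡⟨ ℤP.neg-involutive a ⟨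
    ℤ.- ℤ.- a                  ≡⟨ cong ℤ.-_ (reflMap-neg-snd a b≢0) ⟨
    ℤ.- reflMap a b (ℤ.- b)    ∎
    where open ≡-Reasoning
  ... | apart x≢a x≢b x≢-a x≢-b = ≡-trans
    (reflMap-fixes (neg-≢ x≢-a) (neg-≢ x≢-b) (x≢a ∘ ℤP.neg-injective) (x≢b ∘ ℤP.neg-injective))
    (cong ℤ.-_ (sym (reflMap-fixes x≢a x≢b x≢-a x≢-b)))

  reflMap-involutive : ∀ x → reflMap a b (reflMap a b x) ≡ x
  reflMap-involutive x with position a b x
  ... | at-fst  = ≡-trans (cong (reflMap a b) (reflMap-fst a b)) (reflMap-snd a b)
  ... | at-snd  = ≡-trans (cong (reflMap a b) (reflMap-snd a b)) (reflMap-fst a b)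
  ... | at-fst⁻ = ≡-trans (cong (reflMap a b) (reflMap-neg-fst b a≢0)) (reflMap-neg-snd a b≢0)
  ... | at-snd⁻ = ≡-trans (cong (reflMap a b) (reflMap-neg-snd a b≢0)) (reflMap-neg-fst b a≢0)
  ... | apart x≢a x≢b x≢-a x≢-b = ≡-trans (cong (reflMap a b) fixed) fixed
    where
    fixed : reflMap a b x ≡ x
    fixed = reflMap-fixes x≢a x≢b x≢-a x≢-b

  reflMap-0 : reflMap a b (+ 0) ≡ + 0
  reflMap-0 = reflMap-fixes (a≢0 ∘ sym) (b≢0 ∘ sym) (neg≢0 a≢0 ∘ sym) (neg≢0 b≢0 ∘ sym)

  reflMap-injective : ∀ {x y} → reflMap a b x ≡ reflMap a b y → x ≡ y
  reflMap-injective {x} {y} e =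
    ≡-trans (sym (reflMap-involutive x)) (≡-trans (cong (reflMap a b) e) (reflMap-involutive y))

  reflMap≢0 : ∀ {x} → x ≢ + 0 → reflMap a b x ≢ + 0
  reflMap≢0 x≢0 e = x≢0 (reflMap-injective (≡-trans e (sym reflMap-0)))

  ∣reflMap∣≤ : ∀ {n} → ∣ a ∣ ≤ n → ∣ b ∣ ≤ n → ∀ x → ∣ x ∣ ≤ n → ∣ reflMap a b x ∣ ≤ n
  ∣reflMap∣≤ {n} a≤n b≤n x x≤n with position a b x
  ... | at-fst  = subst (λ y → ∣ y ∣ ≤ n) (sym (reflMap-fst a b)) b≤n
  ... | at-snd  = subst (λ y → ∣ y ∣ ≤ n) (sym (reflMap-snd a b)) a≤n
  ... | at-fst⁻ = subst (λ y → ∣ y ∣ ≤ n) (sym (reflMap-neg-fst b a≢0)) (∣-x∣≤ b b≤n)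
  ... | at-snd⁻ = subst (λ y → ∣ y ∣ ≤ n) (sym (reflMap-neg-snd a b≢0)) (∣-x∣≤ a a≤n)
  ... | apart x≢a x≢b x≢-a x≢-b = subst (λ y → ∣ y ∣ ≤ n) (sym (reflMap-fixes x≢a x≢b x≢-a x≢-b)) x≤n

  reflMap-sym : ∀ x → reflMap a b x ≡ reflMap b a x
  reflMap-sym x with position a b x
  ... | at-fst  = ≡-trans (reflMap-fst a b) (sym (reflMap-snd b a))
  ... | at-snd  = ≡-trans (reflMap-snd a b) (sym (reflMap-fst b a))
  ... | at-fst⁻ = ≡-trans (reflMap-neg-fst b a≢0) (sym (reflMap-neg-snd b a≢0))
  ... | at-snd⁻ = ≡-trans (reflMap-neg-snd a b≢0) (sym (reflMap-neg-fst a b≢0))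
  ... | apart x≢a x≢b x≢-a x≢-b = ≡-trans (reflMap-fixes x≢a x≢b x≢-a x≢-b) (sym (reflMap-fixes x≢b x≢a x≢-b x≢-a))

  reflMap-negate : ∀ x → reflMap (ℤ.- a) (ℤ.- b) x ≡ reflMap a b x
  reflMap-negate x with position a b x
  ... | at-fst⁻ = ≡-trans (reflMap-fst (ℤ.- a) (ℤ.- b)) (sym (reflMap-neg-fst b a≢0))
  ... | at-snd⁻ = ≡-trans (reflMap-snd (ℤ.- a) (ℤ.- b)) (sym (reflMap-neg-snd a b≢0))
  ... | at-fst  = begin
    reflMap (ℤ.- a) (ℤ.- b) a            ≡⟨ cong (reflMap (ℤ.- a) (ℤ.- b)) (ℤP.neg-involutive a) ⟨
    reflMap (ℤ.- a) (ℤ.- b) (ℤ.- ℤ.- a)  ≡⟨ reflMap-neg-fst (ℤ.- b) (neg≢0 a≢0) ⟩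
    ℤ.- ℤ.- b                            ≡⟨ ℤP.neg-involutive b ⟩
    b                                    ≡⟨ reflMap-fst a b ⟨
    reflMap a b a                        ∎
    where open ≡-Reasoning
  ... | at-snd  = begin
    reflMap (ℤ.- a) (ℤ.- b) b            ≡⟨ cong (reflMap (ℤ.- a) (ℤ.- b)) (ℤP.neg-involutive b) ⟨
    reflMap (ℤ.- a) (ℤ.- b) (ℤ.- ℤ.- b)  ≡⟨ reflMap-neg-snd (ℤ.- a) (neg≢0 b≢0) ⟩
    ℤ.- ℤ.- a                            ≡⟨ ℤP.neg-involutive a ⟩
    a                                    ≡⟨ reflMap-snd a b ⟨
    reflMap a b b                        ∎
    where open ≡-Reasoning
  ... | apart x≢a x≢b x≢-a x≢-b = ≡-trans
    (reflMap-fixes x≢-a x≢-b (λ e → x≢a (≡-trans e (ℤP.neg-involutive a))) (λ e → x≢b (≡-trans e (ℤP.neg-involutive b))))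
    (sym (reflMap-fixes x≢a x≢b x≢-a x≢-b))

reflMap-diagonal : ∀ {a} → a ≢ + 0 → ∀ x → reflMap a a x ≡ x
reflMap-diagonal {a} a≢0 x with position a a x
... | at-fst  = reflMap-fst a a
... | at-snd  = reflMap-fst a a
... | at-fst⁻ = reflMap-neg-fst a a≢0
... | at-snd⁻ = reflMap-neg-fst a a≢0
... | apart x≢a x≢b x≢-a x≢-b = reflMap-fixes x≢a x≢b x≢-a x≢-b

-- The reflection in c and d is an odd bijection g, so it carries ±a, ±b to ±g(a), ±g(b), and
-- conjugation by it merely renames the exchanged points.
reflMap-conjugate : ∀ {a b c d} → a ≢ + 0 → b ≢ + 0 → c ≢ + 0 → d ≢ + 0 → ∀ x →
  reflMap c d (reflMap a b x) ≡ reflMap (reflMap c d a) (reflMap c d b) (reflMap c d x)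
reflMap-conjugate {a} {b} {c} {d} a≢0 b≢0 c≢0 d≢0 x with position a b x
... | at-fst  = ≡-trans (cong (reflMap c d) (reflMap-fst a b)) (sym (reflMap-fst (reflMap c d a) _))
... | at-snd  = ≡-trans (cong (reflMap c d) (reflMap-snd a b)) (sym (reflMap-snd _ (reflMap c d b)))
... | at-fst⁻ = begin
  reflMap c d (reflMap a b (ℤ.- a))   ≡⟨ cong (reflMap c d) (reflMap-neg-fst b a≢0) ⟩
  reflMap c d (ℤ.- b)                 ≡⟨ reflMap-neg c≢0 d≢0 b ⟩
  ℤ.- reflMap c d b                   ≡⟨ reflMap-neg-fst (reflMap c d b) (reflMap≢0 c≢0 d≢0 a≢0) ⟨
  reflMap (reflMap c d a) (reflMap c d b) (ℤ.- reflMap c d a)  ≡⟨ cong (reflMap _ _) (reflMap-neg c≢0 d≢0 a) ⟨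
  reflMap (reflMap c d a) (reflMap c d b) (reflMap c d (ℤ.- a))  ∎
  where open ≡-Reasoning
... | at-snd⁻ = begin
  reflMap c d (reflMap a b (ℤ.- b))   ≡⟨ cong (reflMap c d) (reflMap-neg-snd a b≢0) ⟩
  reflMap c d (ℤ.- a)                 ≡⟨ reflMap-neg c≢0 d≢0 a ⟩
  ℤ.- reflMap c d a                   ≡⟨ reflMap-neg-snd (reflMap c d a) (reflMap≢0 c≢0 d≢0 b≢0) ⟨
  reflMap (reflMap c d a) (reflMap c d b) (ℤ.- reflMap c d b)  ≡⟨ cong (reflMap _ _) (reflMap-neg c≢0 d≢0 b) ⟨
  reflMap (reflMap c d a) (reflMap c d b) (reflMap c d (ℤ.- b))  ∎
  where open ≡-Reasoning
... | apart x≢a x≢b x≢-a x≢-b = ≡-trans (cong (reflMap c d) (reflMap-fixes x≢a x≢b x≢-a x≢-b))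
  (sym (reflMap-fixes (x≢a ∘ inj) (x≢b ∘ inj)
    (λ e → x≢-a (inj (≡-trans e (sym (reflMap-neg c≢0 d≢0 a)))))
    (λ e → x≢-b (inj (≡-trans e (sym (reflMap-neg c≢0 d≢0 b)))))))
  where
  inj : ∀ {x y} → reflMap c d x ≡ reflMap c d y → x ≡ y
  inj = reflMap-injective c≢0 d≢0

-- Signed permutations as maps

apply-neg : ∀ {n} (σ : Vec ℤ n) x → apply σ (ℤ.- x) ≡ ℤ.- apply σ x
apply-neg σ (+ zero)  = refl
apply-neg σ (+ suc k) = refl
apply-neg σ -[1+ k ]  = sym (ℤP.neg-involutive (atPos σ k))

atPos-map : ∀ {f : ℤ → ℤ} → f (+ 0) ≡ + 0 → ∀ {n} (σ : Vec ℤ n) k → atPos (Vec.map f σ) k ≡ f (atPos σ k)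
atPos-map f0 []      k       = sym f0
atPos-map f0 (x ∷ σ) zero    = refl
atPos-map f0 (x ∷ σ) (suc k) = atPos-map f0 σ k

apply-∘ : ∀ {n} (σ τ : Vec ℤ n) x → apply (σ ∘ᵛ τ) x ≡ apply σ (apply τ x)
apply-∘ σ τ (+ zero)  = refl
apply-∘ σ τ (+ suc k) = atPos-map refl τ k
apply-∘ σ τ -[1+ k ]  = ≡-trans (cong ℤ.-_ (atPos-map refl τ k)) (sym (apply-neg σ (atPos τ k)))

∘ᵛ-assoc : ∀ {n} (σ τ υ : Vec ℤ n) → (σ ∘ᵛ τ) ∘ᵛ υ ≡ σ ∘ᵛ (τ ∘ᵛ υ)
∘ᵛ-assoc σ τ υ = ≡-trans (VecP.map-cong (apply-∘ σ τ) υ) (VecP.map-∘ (apply σ) (apply τ) υ)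

atPos-ext : ∀ {n} {σ τ : Vec ℤ n} → (∀ k → k < n → atPos σ k ≡ atPos τ k) → σ ≡ τ
atPos-ext {σ = []}    {[]}    _ = refl
atPos-ext {σ = x ∷ σ} {y ∷ τ} e = cong₂ _∷_ (e 0 (s≤s z≤n)) (atPos-ext λ k k<n → e (suc k) (s≤s k<n))

atPos-tabulate : ∀ n (f : ℕ → ℤ) {k} → k < n → atPos (tabulate {n = n} (f ∘ toℕ)) k ≡ f k
atPos-tabulate (suc n) f {zero}  _         = refl
atPos-tabulate (suc n) f {suc k} (s≤s k<n) = atPos-tabulate n (f ∘ suc) k<n

apply-tabulate : ∀ {n} (f : ℤ → ℤ) → f (+ 0) ≡ + 0 → (∀ x → f (ℤ.- x) ≡ ℤ.- f x) →
  ∀ x → ∣ x ∣ ≤ n → apply (tabulate {n = n} (λ k → f (+ suc (toℕ k)))) x ≡ f x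
apply-tabulate f f0 odd (+ zero)  _   = sym f0
apply-tabulate {n} f f0 odd (+ suc k) k<n = atPos-tabulate n (λ k → f (+ suc k)) k<n
apply-tabulate {n} f f0 odd -[1+ k ]  k<n = ≡-trans (cong ℤ.-_ (atPos-tabulate n (λ k → f (+ suc k)) k<n)) (sym (odd (+ suc k)))

apply-id : ∀ {n} x → ∣ x ∣ ≤ n → apply (idᵛ n) x ≡ x
apply-id = apply-tabulate id refl (λ _ → refl)

map-cong-bounded : ∀ {N n} {f g : ℤ → ℤ} {σ : Vec ℤ n} → Bounded N σ → (∀ x → ∣ x ∣ ≤ N → f x ≡ g x) → Vec.map f σ ≡ Vec.map g σ
map-cong-bounded {σ = []}    []       e = refl
map-cong-bounded {σ = x ∷ σ} (b ∷ bd) e = cong₂ _∷_ (e x b) (map-cong-bounded bd e)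

∘ᵛ-identityˡ : ∀ {n} {σ : Vec ℤ n} → Bounded n σ → idᵛ n ∘ᵛ σ ≡ σ
∘ᵛ-identityˡ {σ = σ} bd = ≡-trans (map-cong-bounded bd apply-id) (VecP.map-id σ)

∘ᵛ-identityʳ : ∀ {n} (σ : Vec ℤ n) → σ ∘ᵛ idᵛ n ≡ σ
∘ᵛ-identityʳ {n} σ = atPos-ext λ k k<n →
  ≡-trans (atPos-map refl (idᵛ n) k) (cong (apply σ) (atPos-tabulate n (λ k → + suc k) k<n))

atPos-bounded : ∀ {N n} {σ : Vec ℤ n} → Bounded N σ → ∀ k → ∣ atPos σ k ∣ ≤ N
atPos-bounded {σ = []}    _        k       = z≤n
atPos-bounded {σ = x ∷ σ} (b ∷ bd) zero    = b
atPos-bounded {σ = x ∷ σ} (b ∷ bd) (suc k) = atPos-bounded bd k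

apply-bounded : ∀ {N n} {σ : Vec ℤ n} → Bounded N σ → ∀ x → ∣ apply σ x ∣ ≤ N
apply-bounded bd (+ zero)         = z≤n
apply-bounded bd (+ suc k)        = atPos-bounded bd k
apply-bounded {σ = σ} bd -[1+ k ] = ∣-x∣≤ (atPos σ k) (atPos-bounded bd k)

∘ᵛ-bounded : ∀ {N n} {σ : Vec ℤ n} → Bounded N σ → ∀ τ → Bounded N (σ ∘ᵛ τ)
∘ᵛ-bounded {σ = σ} bd τ rewrite VecP.toList-map (apply σ) τ = AllP.map⁺ (All.universal (apply-bounded bd) (toList τ))

tabulate-bounded : ∀ {N n} {f : Fin n → ℤ} → (∀ k → ∣ f k ∣ ≤ N) → Bounded N (tabulate f)
tabulate-bounded {n = zero}  b = []
tabulate-bounded {n = suc n} b = b zero ∷ tabulate-bounded (b ∘ suc)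

id-bounded : ∀ n → Bounded n (idᵛ n)
id-bounded n = tabulate-bounded FinP.toℕ<n

-- The embedding of B_m into the next group

ext : ∀ {m} → Vec ℤ m → Vec ℤ (suc m)
ext {m} σ = σ Vec.∷ʳ + suc m

atPos-∷ʳ-< : ∀ {m} (σ : Vec ℤ m) v {k} → k < m → atPos (σ Vec.∷ʳ v) k ≡ atPos σ k
atPos-∷ʳ-< (x ∷ σ) v {zero}  _         = refl
atPos-∷ʳ-< (x ∷ σ) v {suc k} (s≤s k<m) = atPos-∷ʳ-< σ v k<m

atPos-∷ʳ-last : ∀ {m} (σ : Vec ℤ m) v → atPos (σ Vec.∷ʳ v) m ≡ v
atPos-∷ʳ-last []      v = refl
atPos-∷ʳ-last (x ∷ σ) v = atPos-∷ʳ-last σ v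

apply-ext : ∀ {m} (σ : Vec ℤ m) x → ∣ x ∣ ≤ m → apply (ext σ) x ≡ apply σ x
apply-ext σ (+ zero)  _   = refl
apply-ext σ (+ suc k) k<m = atPos-∷ʳ-< σ _ k<m
apply-ext σ -[1+ k ]  k<m = cong ℤ.-_ (atPos-∷ʳ-< σ _ k<m)

ext-∘ : ∀ {m} (σ : Vec ℤ m) {τ} → Bounded m τ → ext (σ ∘ᵛ τ) ≡ ext σ ∘ᵛ ext τ
ext-∘ {m} σ {τ} bd = sym (≡-trans (VecP.map-∷ʳ (apply (ext σ)) _ τ)
  (cong₂ Vec._∷ʳ_ (map-cong-bounded bd (apply-ext σ)) (atPos-∷ʳ-last σ _)))

atPos-ext-≡ : ∀ {m} {σ : Vec ℤ m} {τ : Vec ℤ (suc m)} → (∀ {k} → k < m → atPos σ k ≡ atPos τ k) → atPos τ m ≡ + suc m → ext σ ≡ τ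
atPos-ext-≡ {m} {σ} {τ} low top = atPos-ext go
  where
  go : ∀ k → k < suc m → atPos (ext σ) k ≡ atPos τ k
  go k k<1+m with k ℕ.≟ m
  ... | yes refl = ≡-trans (atPos-∷ʳ-last σ _) (sym top)
  ... | no k≢m   = let k<m = ℕP.≤∧≢⇒< (ℕP.≤-pred k<1+m) k≢m in ≡-trans (atPos-∷ʳ-< σ _ k<m) (low k<m)

ext-id : ∀ m → ext (idᵛ m) ≡ idᵛ (suc m)
ext-id m = atPos-ext-≡ (λ k<m → ≡-trans (atPos-tabulate m (λ k → + suc k) k<m) (sym (atPos-tabulate (suc m) (λ k → + suc k) (ℕP.m≤n⇒m≤1+n k<m))))
  (atPos-tabulate (suc m) (λ k → + suc k) ℕP.≤-refl)

-- A record, and not a synonym of InRange n ∣ a ∣, so that a can be inferred from Index n a.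
record Index (n : ℕ) (a : ℤ) : Set where
  constructor index
  field inRange : InRange n ∣ a ∣
  lower : 1 ≤ ∣ a ∣
  lower = proj₁ inRange
  upper : ∣ a ∣ ≤ n
  upper = proj₂ inRange

open Index

Index⇒≢0 : ∀ {n a} → Index n a → a ≢ + 0
Index⇒≢0 (index (() , _)) refl

Index-neg : ∀ {n} a → Index n a → Index n (ℤ.- a)
Index-neg {n} a (index r) = index (subst (InRange n) (sym (ℤP.∣-i∣≡∣i∣ a)) r)

Index-suc : ∀ {n a} → Index n a → Index (suc n) a
Index-suc (index (l , u)) = index (l , ℕP.m≤n⇒m≤1+n u)

-- In contrast to `reflB`, both points may be negative, as happens after conjugation, and they may
-- be equal, which gives the identity and thereby the trivial growth step.
refl𝕍 : ∀ n → ℤ → ℤ → Vec ℤ n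
refl𝕍 n a b = tabulate (λ k → reflMap a b (+ suc (toℕ k)))

≢0⇒1≤ : ∀ {x} → x ≢ + 0 → 1 ≤ ∣ x ∣
≢0⇒1≤ {+ zero}   x≢0 = contradiction refl x≢0
≢0⇒1≤ {+ suc _}  _   = s≤s z≤n
≢0⇒1≤ { -[1+ _ ]} _   = s≤s z≤n

module _ {n a b} (ia : Index n a) (ib : Index n b) where

  Index-reflMap : ∀ {x} → Index n x → Index n (reflMap a b x)
  Index-reflMap {x} ix = index
    ( ≢0⇒1≤ (reflMap≢0 (Index⇒≢0 ia) (Index⇒≢0 ib) (Index⇒≢0 ix))
    , ∣reflMap∣≤ (Index⇒≢0 ia) (Index⇒≢0 ib) (upper ia) (upper ib) x (upper ix))

  apply-refl : ∀ x → ∣ x ∣ ≤ n → apply (refl𝕍 n a b) x ≡ reflMap a b x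
  apply-refl = apply-tabulate (reflMap a b) (reflMap-0 (Index⇒≢0 ia) (Index⇒≢0 ib)) (reflMap-neg (Index⇒≢0 ia) (Index⇒≢0 ib))

  refl-bounded : Bounded n (refl𝕍 n a b)
  refl-bounded = tabulate-bounded λ k → ∣reflMap∣≤ (Index⇒≢0 ia) (Index⇒≢0 ib) (upper ia) (upper ib) (+ suc (toℕ k)) (FinP.toℕ<n k)

atPos-refl∘refl : ∀ {n a b c d} → Index n a → Index n b → Index n c → Index n d → ∀ {k} → k < n →
  atPos (refl𝕍 n a b ∘ᵛ refl𝕍 n c d) k ≡ reflMap a b (reflMap c d (+ suc k))
atPos-refl∘refl {n} {a} {b} {c} {d} ia ib ic id {k} k<n = begin
  atPos (refl𝕍 n a b ∘ᵛ refl𝕍 n c d) k         ≡⟨ atPos-map refl (refl𝕍 n c d) k ⟩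
  apply (refl𝕍 n a b) (atPos (refl𝕍 n c d) k)  ≡⟨ cong (apply (refl𝕍 n a b)) (atPos-tabulate n (λ k → reflMap c d (+ suc k)) k<n) ⟩
  apply (refl𝕍 n a b) (reflMap c d (+ suc k))  ≡⟨ apply-refl ia ib (reflMap c d (+ suc k)) (∣reflMap∣≤ (Index⇒≢0 ic) (Index⇒≢0 id) (upper ic) (upper id) (+ suc k) k<n) ⟩
  reflMap a b (reflMap c d (+ suc k))          ∎
  where open ≡-Reasoning

refl∘refl-cong : ∀ {n a b c d a′ b′ c′ d′} →
  Index n a → Index n b → Index n c → Index n d → Index n a′ → Index n b′ → Index n c′ → Index n d′ →
  (∀ x → reflMap a b (reflMap c d x) ≡ reflMap a′ b′ (reflMap c′ d′ x)) →
  refl𝕍 n a b ∘ᵛ refl𝕍 n c d ≡ refl𝕍 n a′ b′ ∘ᵛ refl𝕍 n c′ d′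
refl∘refl-cong ia ib ic id ia′ ib′ ic′ id′ e = atPos-ext λ k k<n →
  ≡-trans (atPos-refl∘refl ia ib ic id k<n) (≡-trans (e (+ suc k)) (sym (atPos-refl∘refl ia′ ib′ ic′ id′ k<n)))

refl-cong : ∀ n {a b a′ b′} → (∀ x → reflMap a b x ≡ reflMap a′ b′ x) → refl𝕍 n a b ≡ refl𝕍 n a′ b′
refl-cong n e = VecP.tabulate-cong (λ k → e (+ suc (toℕ k)))

refl-diagonal : ∀ {n a} → Index n a → refl𝕍 n a a ≡ idᵛ n
refl-diagonal ia = VecP.tabulate-cong (λ k → reflMap-diagonal (Index⇒≢0 ia) (+ suc (toℕ k)))

refl-involutive : ∀ {n a b} → Index n a → Index n b → refl𝕍 n a b ∘ᵛ refl𝕍 n a b ≡ idᵛ n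
refl-involutive {n} {a} {b} ia ib = atPos-ext λ k k<n → ≡-trans (atPos-refl∘refl ia ib ia ib k<n)
  (≡-trans (reflMap-involutive (Index⇒≢0 ia) (Index⇒≢0 ib) (+ suc k)) (sym (atPos-tabulate n (λ k → + suc k) k<n)))

refl-conjugate : ∀ {n a b c d} → Index n a → Index n b → Index n c → Index n d →
  refl𝕍 n c d ∘ᵛ refl𝕍 n a b ≡ refl𝕍 n (reflMap c d a) (reflMap c d b) ∘ᵛ refl𝕍 n c d
refl-conjugate ia ib ic id = refl∘refl-cong ic id ia ib (Index-reflMap ic id ia) (Index-reflMap ic id ib) ic id
  (reflMap-conjugate (Index⇒≢0 ia) (Index⇒≢0 ib) (Index⇒≢0 ic) (Index⇒≢0 id))

top : ℕ → ℤ
top m = + suc m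

Index-top : ∀ m → Index (suc m) (top m)
Index-top m = index (s≤s z≤n , ℕP.≤-refl)

low≢top : ∀ {m a} → Index m a → top m ≢ a
low≢top (index (_ , u)) refl = ℕP.<-irrefl refl u

low≢-top : ∀ {m a} → Index m a → top m ≢ ℤ.- a
low≢-top {m} {a} ia = low≢top (Index-neg a ia)

reflMap-top : ∀ {m a b} → Index m a → Index m b → reflMap a b (top m) ≡ top m
reflMap-top ia ib = reflMap-fixes (low≢top ia) (low≢top ib) (low≢-top ia) (low≢-top ib)

ext-refl : ∀ {m a b} → Index m a → Index m b → ext (refl𝕍 m a b) ≡ refl𝕍 (suc m) a b
ext-refl {m} {a} {b} ia ib = atPos-ext-≡
  (λ k<m → ≡-trans (atPos-tabulate m f k<m) (sym (atPos-tabulate (suc m) f (ℕP.m≤n⇒m≤1+n k<m))))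
  (≡-trans (atPos-tabulate (suc m) f ℕP.≤-refl) (reflMap-top ia ib))
  where
  f : ℕ → ℤ
  f k = reflMap a b (+ suc k)

-- Sorting

act : Sign → ℤ → ℤ
act Sign.+ x = x
act Sign.- x = ℤ.- x

act-involutive : ∀ s x → act s (act s x) ≡ x
act-involutive Sign.+ x = refl
act-involutive Sign.- x = ℤP.neg-involutive x

∣act∣ : ∀ s x → ∣ act s x ∣ ≡ ∣ x ∣
∣act∣ Sign.+ x = refl
∣act∣ Sign.- x = ℤP.∣-i∣≡∣i∣ x

-- The one-line form of right multiplication by the reflection (s p , m + 1), as `displace-product`
-- shows. In this form positions, inverse and signs can be followed by recursion on p.
displace : ∀ {m} → Sign → ℤ → Fin (suc m) → Vec ℤ m → Vec ℤ (suc m)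
displace s v zero    []      = v ∷ []
displace s v zero    (x ∷ σ) = v ∷ (σ Vec.∷ʳ act s x)
displace s v (suc p) (x ∷ σ) = x ∷ displace s v p σ

undisplace : ∀ {m} → Sign → Fin (suc m) → Vec ℤ (suc m) → Vec ℤ m
undisplace {zero}  s p       τ       = []
undisplace {suc m} s zero    (_ ∷ τ) = act s (Vec.last τ) ∷ Vec.init τ
undisplace {suc m} s (suc p) (x ∷ τ) = x ∷ undisplace s p τ

abs-displace : ∀ {m} s v p (σ : Vec ℤ m) → abs (displace s v p σ) ↭ ∣ v ∣ ∷ abs σ
abs-displace s v zero    []      = ↭-refl
abs-displace s v zero    (x ∷ σ) = ↭-prep ∣ v ∣ (begin
  map ∣_∣ (toList (σ Vec.∷ʳ act s x))      ≡⟨ cong (map ∣_∣) (VecP.toList-∷ʳ (act s x) σ) ⟩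
  map ∣_∣ (toList σ ++ act s x ∷ [])       ≡⟨ ListP.map-++ ∣_∣ (toList σ) _ ⟩
  abs σ ++ ∣ act s x ∣ ∷ []                ≡⟨ cong (λ a → abs σ ++ a ∷ []) (∣act∣ s x) ⟩
  abs σ ++ ∣ x ∣ ∷ []                      ↭⟨ ↭P.∷↭∷ʳ ∣ x ∣ (abs σ) ⟨
  ∣ x ∣ ∷ abs σ                            ∎)
  where open PermutationReasoning
abs-displace s v (suc p) (x ∷ σ) = ↭-trans (↭-prep ∣ x ∣ (abs-displace s v p σ)) (↭-swap ∣ x ∣ ∣ v ∣ ↭-refl)

lookup-displace : ∀ {m} s v p (σ : Vec ℤ m) → lookup (displace s v p σ) p ≡ v
lookup-displace s v zero    []      = refl
lookup-displace s v zero    (x ∷ σ) = refl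
lookup-displace s v (suc p) (x ∷ σ) = lookup-displace s v p σ

undisplace-displace : ∀ {m} s v p (σ : Vec ℤ m) → undisplace s p (displace s v p σ) ≡ σ
undisplace-displace s v zero    []      = refl
undisplace-displace s v zero    (x ∷ σ) = cong₂ _∷_
  (≡-trans (cong (act s) (VecP.last-∷ʳ (act s x) σ)) (act-involutive s x)) (VecP.init-∷ʳ (act s x) σ)
undisplace-displace s v (suc p) (x ∷ σ) = cong (x ∷_) (undisplace-displace s v p σ)

displace-undisplace : ∀ {m} s p (τ : Vec ℤ (suc m)) → displace s (lookup τ p) p (undisplace s p τ) ≡ τ
displace-undisplace {zero}  s zero    (x ∷ []) = refl
displace-undisplace {suc m} s zero    (x ∷ τ)  = cong (x ∷_)
  (≡-trans (cong (Vec.init τ Vec.∷ʳ_) (act-involutive s (Vec.last τ))) (sym (proj₂ (proj₂ (Vec.initLast τ)))))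
displace-undisplace {suc m} s (suc p) (x ∷ τ)  = cong (x ∷_) (displace-undisplace s p τ)

isLast : ∀ {m} → Fin (suc m) → Bool
isLast {zero}  _       = true
isLast {suc m} zero    = false
isLast {suc m} (suc p) = isLast p

evenNeg-∷ : ∀ {n} x (σ : Vec ℤ n) → evenNeg (x ∷ σ) ≡ (x <ᶻ + 0) xor evenNeg σ
evenNeg-∷ x σ with x <ᶻ + 0
... | true  = even-suc (negCount σ)
... | false = refl

evenNeg-∷ʳ : ∀ {n} x (σ : Vec ℤ n) → evenNeg (σ Vec.∷ʳ x) ≡ evenNeg (x ∷ σ)
evenNeg-∷ʳ x σ = cong even (≡-trans (cong (count (_<ᶻ + 0)) (VecP.toList-∷ʳ x σ))
  (count-↭ (_<ᶻ + 0) (↭-sym (↭P.∷↭∷ʳ x (toList σ)))))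

neg-<0 : ∀ {x} → x ≢ + 0 → (ℤ.- x <ᶻ + 0) ≡ not (x <ᶻ + 0)
neg-<0 {+ zero}   x≢0 = contradiction refl x≢0
neg-<0 {+ suc _}  _   = refl
neg-<0 { -[1+ _ ]} _   = refl

xor-swap : ∀ x y z → x xor (y xor z) ≡ y xor (x xor z)
xor-swap true  true  z = refl
xor-swap true  false z = refl
xor-swap false true  z = refl
xor-swap false false z = refl

not-xor : ∀ x y → not (not x xor y) ≡ x xor y
not-xor true  y = refl
not-xor false y = not-involutive y

-- For s = - and p not last, two signs change: the new letter is negative and the entry moved to the
-- end is negated. Only (-(m + 1) , m + 1) changes a single sign. Negation is known to change the
-- sign of an entry only if the entry is not 0.
evenNeg-displace : ∀ {m} s k p (σ : Vec ℤ m) → All (λ x → x ≢ + 0) (toList σ) →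
  evenNeg (displace s (letter s k) p σ) ≡ (isNegative s ∧ isLast p) xor evenNeg σ
evenNeg-displace Sign.+ k zero [] _ = refl
evenNeg-displace Sign.- k zero [] _ = refl
evenNeg-displace Sign.+ k zero (x ∷ σ) _ = evenNeg-∷ʳ x σ
evenNeg-displace Sign.- k zero (x ∷ σ) (x≢0 ∷ _) = begin
  evenNeg (-[1+ k ] ∷ (σ Vec.∷ʳ ℤ.- x))       ≡⟨ evenNeg-∷ -[1+ k ] (σ Vec.∷ʳ ℤ.- x) ⟩
  not (evenNeg (σ Vec.∷ʳ ℤ.- x))              ≡⟨ cong not (≡-trans (evenNeg-∷ʳ (ℤ.- x) σ) (evenNeg-∷ (ℤ.- x) σ)) ⟩
  not ((ℤ.- x <ᶻ + 0) xor evenNeg σ)          ≡⟨ cong (λ b → not (b xor evenNeg σ)) (neg-<0 x≢0) ⟩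
  not (not (x <ᶻ + 0) xor evenNeg σ)          ≡⟨ not-xor (x <ᶻ + 0) (evenNeg σ) ⟩
  (x <ᶻ + 0) xor evenNeg σ                    ≡⟨ evenNeg-∷ x σ ⟨
  evenNeg (x ∷ σ)                             ∎
  where open ≡-Reasoning
evenNeg-displace s k (suc p) (x ∷ σ) (_ ∷ σ≢0) = begin
  evenNeg (x ∷ displace s (letter s k) p σ)                   ≡⟨ evenNeg-∷ x _ ⟩
  (x <ᶻ + 0) xor evenNeg (displace s (letter s k) p σ)        ≡⟨ cong ((x <ᶻ + 0) xor_) (evenNeg-displace s k p σ σ≢0) ⟩
  (x <ᶻ + 0) xor ((isNegative s ∧ isLast p) xor evenNeg σ)    ≡⟨ xor-swap (x <ᶻ + 0) (isNegative s ∧ isLast p) (evenNeg σ) ⟩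
  (isNegative s ∧ isLast p) xor ((x <ᶻ + 0) xor evenNeg σ)    ≡⟨ cong ((isNegative s ∧ isLast p) xor_) (evenNeg-∷ x σ) ⟨
  (isNegative s ∧ isLast p) xor evenNeg (x ∷ σ)               ∎
  where open ≡-Reasoning

Signed⇒≢0 : ∀ {m} {σ : Vec ℤ m} → Signed σ → All (λ x → x ≢ + 0) (toList σ)
Signed⇒≢0 (rng , _) = All.map (λ { (() , _) refl }) (AllP.map⁻ rng)

sorting : Scheme
sorting = record
  { step         = λ { {m} (s , p) σ → displace s (letter s m) p σ }
  ; unstep       = λ (s , p) τ → undisplace s p τ
  ; flips        = λ (s , p) → isNegative s ∧ isLast p
  ; abs-step     = λ { {m} (s , p) σ → ↭-trans (abs-displace s (letter s m) p σ) (↭-reflexive (cong (_∷ abs σ) (∣letter∣ s m))) }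
  ; lookup-step  = λ { {m} s p σ → lookup-displace s (letter s m) p σ }
  ; unstep-step  = λ { {m} (s , p) σ → undisplace-displace s (letter s m) p σ }
  ; step-unstep  = λ s p τ e → ≡-trans (cong (λ v → displace s v p (undisplace s p τ)) (sym e)) (displace-undisplace s p τ)
  ; evenNeg-step = λ { {m} (s , p) {σ} σ-signed → evenNeg-displace s m p σ (Signed⇒≢0 σ-signed) }
  }

open module Sorting = Growth sorting using () renaming (Built to Sorted)

-- The sorting step as multiplication by a reflection

atPos-displace-here : ∀ {m} s v p (σ : Vec ℤ m) → atPos (displace s v p σ) (toℕ p) ≡ v
atPos-displace-here s v zero    []      = refl
atPos-displace-here s v zero    (x ∷ σ) = refl
atPos-displace-here s v (suc p) (x ∷ σ) = atPos-displace-here s v p σ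

atPos-displace-last : ∀ {m} s v (p : Fin (suc m)) (σ : Vec ℤ m) → m ≢ toℕ p → atPos (displace s v p σ) m ≡ act s (atPos σ (toℕ p))
atPos-displace-last s v zero    []      m≢p = contradiction refl m≢p
atPos-displace-last s v zero    (x ∷ σ) _   = atPos-∷ʳ-last σ (act s x)
atPos-displace-last s v (suc p) (x ∷ σ) m≢p = atPos-displace-last s v p σ (m≢p ∘ cong suc)

atPos-displace-other : ∀ {m} s v (p : Fin (suc m)) (σ : Vec ℤ m) {k} → k < m → k ≢ toℕ p → atPos (displace s v p σ) k ≡ atPos σ k
atPos-displace-other s v zero    (x ∷ σ) {zero}  _         k≢p = contradiction refl k≢p
atPos-displace-other s v zero    (x ∷ σ) {suc k} (s≤s k<m) _   = atPos-∷ʳ-< σ (act s x) k<m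
atPos-displace-other s v (suc p) (x ∷ σ) {zero}  _         _   = refl
atPos-displace-other s v (suc p) (x ∷ σ) {suc k} (s≤s k<m) k≢p = atPos-displace-other s v p σ k<m (k≢p ∘ cong suc)

Index-letter : ∀ {m} s (p : Fin m) → Index m (letter s (toℕ p))
Index-letter {m} s p = index (subst (InRange m) (sym (∣letter∣ s (toℕ p))) (s≤s z≤n , FinP.toℕ<n p))

apply-letter : ∀ {n} (σ : Vec ℤ n) s k → apply σ (letter s k) ≡ act s (atPos σ k)
apply-letter σ Sign.+ k = refl
apply-letter σ Sign.- k = refl

displace-product : ∀ {m} s p (σ : Vec ℤ m) →
  displace s (letter s m) p σ ≡ ext σ ∘ᵛ refl𝕍 (suc m) (letter s (toℕ p)) (top m)
displace-product {m} s p σ = atPos-ext λ k k<1+m → ≡-trans (pointwise k k<1+m) (sym (right k k<1+m))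
  where
  i : ℤ
  i = letter s (toℕ p)
  right : ∀ k → k < suc m → atPos (ext σ ∘ᵛ refl𝕍 (suc m) i (top m)) k ≡ apply (ext σ) (reflMap i (top m) (+ suc k))
  right k k<1+m = ≡-trans (atPos-map refl (refl𝕍 (suc m) i (top m)) k)
    (cong (apply (ext σ)) (atPos-tabulate (suc m) (λ k → reflMap i (top m) (+ suc k)) k<1+m))
  reflMap-letter : ∀ s k → reflMap (letter s k) (top m) (+ suc k) ≡ letter s m
  reflMap-letter Sign.+ k = reflMap-fst (+ suc k) (top m)
  reflMap-letter Sign.- k = reflMap-neg-fst { -[1+ k ]} (top m) (λ ())
  apply-ext-letter : ∀ s → apply (ext σ) (letter s m) ≡ letter s m
  apply-ext-letter Sign.+ = atPos-∷ʳ-last σ (top m)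
  apply-ext-letter Sign.- = cong ℤ.-_ (atPos-∷ʳ-last σ (top m))
  letter-≢ : ∀ {s k k′} → k ≢ k′ → letter Sign.+ k ≢ letter s k′
  letter-≢ k≢k′ e = k≢k′ (proj₂ (letter-injective e))
  -letter : ∀ s k → ℤ.- letter s k ≡ letter (Sign.opposite s) k
  -letter Sign.+ k = refl
  -letter Sign.- k = refl
  pointwise : ∀ k → k < suc m → atPos (displace s (letter s m) p σ) k ≡ apply (ext σ) (reflMap i (top m) (+ suc k))
  -- Position p is tested before position m, so the first case also covers p = m, where the two
  -- exchanged positions coincide.
  pointwise k k<1+m with k ℕ.≟ toℕ p
  ... | yes refl = begin
    atPos (displace s (letter s m) p σ) (toℕ p)              ≡⟨ atPos-displace-here s (letter s m) p σ ⟩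
    letter s m                                               ≡⟨ apply-ext-letter s ⟨
    apply (ext σ) (letter s m)                               ≡⟨ cong (apply (ext σ)) (reflMap-letter s (toℕ p)) ⟨
    apply (ext σ) (reflMap i (top m) (+ suc (toℕ p)))        ∎
    where open ≡-Reasoning
  ... | no k≢p with k ℕ.≟ m
  ...   | yes refl = begin
    atPos (displace s (letter s m) p σ) m                    ≡⟨ atPos-displace-last s (letter s m) p σ k≢p ⟩
    act s (atPos σ (toℕ p))                                  ≡⟨ cong (act s) (atPos-∷ʳ-< σ (top m) p<m) ⟨
    act s (atPos (ext σ) (toℕ p))                            ≡⟨ apply-letter (ext σ) s (toℕ p) ⟨
    apply (ext σ) i                                          ≡⟨ cong (apply (ext σ)) (reflMap-snd i (top m)) ⟨
    apply (ext σ) (reflMap i (top m) (top m))                ∎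
    where
    open ≡-Reasoning
    p<m : toℕ p < m
    p<m = ℕP.≤∧≢⇒< (ℕP.≤-pred (FinP.toℕ<n p)) (k≢p ∘ sym)
  ...   | no k≢m = begin
    atPos (displace s (letter s m) p σ) k                    ≡⟨ atPos-displace-other s (letter s m) p σ k<m k≢p ⟩
    atPos σ k                                                ≡⟨ atPos-∷ʳ-< σ (top m) k<m ⟨
    apply (ext σ) (+ suc k)                                  ≡⟨ cong (apply (ext σ)) (reflMap-fixes
                                                                  (letter-≢ {s} k≢p) (letter-≢ {Sign.+} k≢m)
                                                                  (λ e → letter-≢ {Sign.opposite s} k≢p (≡-trans e (-letter s (toℕ p)))) (λ ())) ⟨
    apply (ext σ) (reflMap i (top m) (+ suc k))              ∎
    where
    open ≡-Reasoning
    k<m : k < m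
    k<m = ℕP.≤∧≢⇒< (ℕP.≤-pred k<1+m) k≢m

-- With top m in the role of n: (a , n)(−a , n) = (−a , a)(−n , n).
reflMap-opposite : ∀ {m a} → Index m a → ∀ x →
  reflMap a (top m) (reflMap (ℤ.- a) (top m) x) ≡ reflMap (ℤ.- a) a (reflMap (ℤ.- top m) (top m) x)
reflMap-opposite {m} {a} ia x with position a (top m) x
... | at-fst = begin
  reflMap a (top m) (reflMap (ℤ.- a) (top m) a)    ≡⟨ cong (reflMap a (top m)) (≡-trans (cong (reflMap (ℤ.- a) (top m)) (sym (ℤP.neg-involutive a))) (reflMap-neg-fst (top m) (neg≢0 a≢0))) ⟩
  reflMap a (top m) (ℤ.- top m)                    ≡⟨ reflMap-neg-snd a {top m} (λ ()) ⟩
  ℤ.- a                                            ≡⟨ reflMap-snd (ℤ.- a) a ⟨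
  reflMap (ℤ.- a) a a                              ≡⟨ cong (reflMap (ℤ.- a) a) fixed ⟨
  reflMap (ℤ.- a) a (reflMap (ℤ.- top m) (top m) a) ∎
  where
  open ≡-Reasoning
  a≢0 : a ≢ + 0
  a≢0 = Index⇒≢0 ia
  fixed : reflMap (ℤ.- top m) (top m) a ≡ a
  fixed = reflMap-fixes (λ e → low≢-top ia (sym (neg-swap (sym e)))) (low≢top ia ∘ sym) (low≢top ia ∘ sym) (λ e → low≢-top ia (sym (neg-swap (sym e))))
... | at-snd = begin
  reflMap a (top m) (reflMap (ℤ.- a) (top m) (top m))  ≡⟨ cong (reflMap a (top m)) (reflMap-snd (ℤ.- a) (top m)) ⟩
  reflMap a (top m) (ℤ.- a)                            ≡⟨ reflMap-neg-fst (top m) (Index⇒≢0 ia) ⟩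
  ℤ.- top m                                            ≡⟨ reflMap-neg (neg≢0 (Index⇒≢0 ia)) (Index⇒≢0 ia) (top m) ∙ cong ℤ.-_ (reflMap-top (Index-neg a ia) ia) ⟨
  reflMap (ℤ.- a) a (ℤ.- top m)                        ≡⟨ cong (reflMap (ℤ.- a) a) (reflMap-snd (ℤ.- top m) (top m)) ⟨
  reflMap (ℤ.- a) a (reflMap (ℤ.- top m) (top m) (top m)) ∎
  where
  open ≡-Reasoning
  _∙_ : ∀ {x y z : ℤ} → x ≡ y → y ≡ z → x ≡ z
  _∙_ = ≡-trans
... | at-fst⁻ = begin
  reflMap a (top m) (reflMap (ℤ.- a) (top m) (ℤ.- a))  ≡⟨ cong (reflMap a (top m)) (reflMap-fst (ℤ.- a) (top m)) ⟩
  reflMap a (top m) (top m)                            ≡⟨ reflMap-snd a (top m) ⟩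
  a                                                    ≡⟨ reflMap-fst (ℤ.- a) a ⟨
  reflMap (ℤ.- a) a (ℤ.- a)                            ≡⟨ cong (reflMap (ℤ.- a) a) fixed ⟨
  reflMap (ℤ.- a) a (reflMap (ℤ.- top m) (top m) (ℤ.- a)) ∎
  where
  open ≡-Reasoning
  fixed : reflMap (ℤ.- top m) (top m) (ℤ.- a) ≡ ℤ.- a
  fixed = reflMap-fixes (λ e → low≢top ia (sym (ℤP.neg-injective e))) (low≢-top ia ∘ sym) (low≢-top ia ∘ sym) (λ e → low≢top ia (sym (ℤP.neg-injective e)))
... | at-snd⁻ = begin
  reflMap a (top m) (reflMap (ℤ.- a) (top m) (ℤ.- top m))  ≡⟨ cong (reflMap a (top m)) (≡-trans (reflMap-neg-snd (ℤ.- a) {top m} (λ ())) (ℤP.neg-involutive a)) ⟩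
  reflMap a (top m) a                                  ≡⟨ reflMap-fst a (top m) ⟩
  top m                                                ≡⟨ reflMap-top (Index-neg a ia) ia ⟨
  reflMap (ℤ.- a) a (top m)                            ≡⟨ cong (reflMap (ℤ.- a) a) (reflMap-fst (ℤ.- top m) (top m)) ⟨
  reflMap (ℤ.- a) a (reflMap (ℤ.- top m) (top m) (ℤ.- top m)) ∎
  where open ≡-Reasoning
... | apart x≢a x≢n x≢-a x≢-n = begin
  reflMap a (top m) (reflMap (ℤ.- a) (top m) x)  ≡⟨ cong (reflMap a (top m)) (reflMap-fixes x≢-a x≢n x≢--a x≢-n) ⟩
  reflMap a (top m) x                            ≡⟨ reflMap-fixes x≢a x≢n x≢-a x≢-n ⟩
  x                                              ≡⟨ reflMap-fixes x≢-a x≢a x≢--a x≢-a ⟨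
  reflMap (ℤ.- a) a x                            ≡⟨ cong (reflMap (ℤ.- a) a) (reflMap-fixes x≢-n x≢n x≢n x≢-n) ⟨
  reflMap (ℤ.- a) a (reflMap (ℤ.- top m) (top m) x) ∎
  where
  open ≡-Reasoning
  x≢--a : x ≢ ℤ.- ℤ.- a
  x≢--a e = x≢a (≡-trans e (ℤP.neg-involutive a))

-- The length is at most increased by one under a reflection

-- The exponent of t for the growth step by (a , m + 1). For a in range it is 0 only if a = m + 1 or
-- m = 0.
cost : ℕ → ℤ → ℕ
cost m (+ a)    = 1 ⊓ (suc m ∸ a)
cost m -[1+ a ] = 1 ⊓ (m + a)

cost-letter : ∀ {m} (c : Choice m) → cost m (letter (proj₁ c) (toℕ (proj₂ c))) ≡ 1 ⊓ degree m c
cost-letter (Sign.+ , p) = refl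
cost-letter (Sign.- , p) = refl

cost≤1 : ∀ m a → cost m a ≤ 1
cost≤1 m (+ a)    = ℕP.m⊓n≤m 1 (suc m ∸ a)
cost≤1 m -[1+ a ] = ℕP.m⊓n≤m 1 (m + a)

cost-top : ∀ m → cost m (top m) ≡ 0
cost-top m = cong (1 ⊓_) (ℕP.n∸n≡0 m)

cost-0 : ∀ {a} → Index 1 a → cost 0 a ≡ 0
cost-0 {+ zero}         (index (() , _))
cost-0 {+ suc zero}     _ = refl
cost-0 {+ suc (suc _)}  (index (_ , s≤s ()))
cost-0 { -[1+ zero ]}    _ = refl
cost-0 { -[1+ suc _ ]}   (index (_ , s≤s ()))

cost-suc : ∀ {m a} → Index (suc (suc m)) a → a ≢ top (suc m) → cost (suc m) a ≡ 1
cost-suc {m} {+ a} (index (_ , u)) a≢top = ℕP.m≤n⇒m⊓n≡m (ℕP.m<n⇒0<n∸m (ℕP.≤∧≢⇒< u (λ e → a≢top (cong +_ e))))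
cost-suc {a = -[1+ _ ]} _ _ = refl

-- For m = 0 every cost is 0, and for m > 0 the element a already has the largest cost 1.
cost-mono : ∀ {m a b} → Index (suc m) a → Index (suc m) b → a ≢ top m → cost m b ≤ cost m a
cost-mono {zero}  ia ib a≢top = ℕP.≤-reflexive (≡-trans (cost-0 ib) (sym (cost-0 ia)))
cost-mono {suc m} {b = b} ia ib a≢top = subst (cost (suc m) b ≤_) (sym (cost-suc ia a≢top)) (cost≤1 (suc m) b)

-- Only the number of factors with j > 1 is bounded. The exponent of q is left open, as the argument
-- about length does not follow it.
Sorted≤ : ∀ n → Vec ℤ n → ℕ → Set
Sorted≤ n σ c = ∃₂ λ s c′ → Sorted n σ (s , c′) × c′ ≤ c

Index⇒letter : ∀ {m a} → Index m a → ∃₂ λ s (p : Fin m) → a ≡ letter s (toℕ p)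
Index⇒letter {a = + zero}   (index (() , _))
Index⇒letter {a = + suc k}  (index (_ , k<m)) = Sign.+ , fromℕ< k<m , cong (λ j → + suc j) (sym (FinP.toℕ-fromℕ< k<m))
Index⇒letter {a = -[1+ k ]} (index (_ , k<m)) = Sign.- , fromℕ< k<m , cong -[1+_] (sym (FinP.toℕ-fromℕ< k<m))

Sorted≤-grow : ∀ {m σ c d a} → Sorted≤ m σ c → Index (suc m) a → cost m a ≤ d →
  Sorted≤ (suc m) (ext σ ∘ᵛ refl𝕍 (suc m) a (top m)) (c + d)
Sorted≤-grow {m} {σ} {d = d} (s , c′ , σ-sorted , c′≤c) ia a≤d with Index⇒letter ia
... | sgn , p , refl = _ , _ , subst (λ τ → Sorted (suc m) τ _) (displace-product sgn p σ) (Growth.grow (sgn , p) σ-sorted) ,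
  ℕP.+-mono-≤ c′≤c (subst (_≤ d) (cost-letter (sgn , p)) a≤d)

Sorted≤-resp : ∀ {n σ τ c} → σ ≡ τ → Sorted≤ n σ c → Sorted≤ n τ c
Sorted≤-resp refl b = b

Sorted≤-weaken : ∀ {n σ c d} → c ≤ d → Sorted≤ n σ c → Sorted≤ n σ d
Sorted≤-weaken c≤d (s , c′ , σ-sorted , c′≤c) = s , c′ , σ-sorted , ℕP.≤-trans c′≤c c≤d

index-cases : ∀ {m a} → Index (suc m) a → a ≡ top m ⊎ a ≡ ℤ.- top m ⊎ Index m a
index-cases {m} {a} ia@(index (l , u)) with ∣ a ∣ ℕ.≟ suc m
... | no ≢ = inj₂ (inj₂ (index (l , ℕP.≤-pred (ℕP.≤∧≢⇒< u ≢))))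
... | yes e with letter-surjective a e
...   | Sign.+ , refl = inj₁ refl
...   | Sign.- , refl = inj₂ (inj₁ refl)

refl-symmetric : ∀ {n a b} → Index n a → Index n b → refl𝕍 n a b ≡ refl𝕍 n b a
refl-symmetric {n} ia ib = refl-cong n (reflMap-sym (Index⇒≢0 ia) (Index⇒≢0 ib))

refl-negate : ∀ {n a b} → Index n a → Index n b → refl𝕍 n (ℤ.- a) (ℤ.- b) ≡ refl𝕍 n a b
refl-negate {n} ia ib = refl-cong n (reflMap-negate (Index⇒≢0 ia) (Index⇒≢0 ib))

-- Once a product of two reflections begins with a reflection in points at most m, that one can be
-- absorbed into σ, where the induction hypothesis applies.
reflect-low : ∀ {m} σ {x y} t u v → Index m x → Index m y → t ∘ᵛ u ≡ refl𝕍 (suc m) x y ∘ᵛ v →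
  (ext σ ∘ᵛ t) ∘ᵛ u ≡ ext (σ ∘ᵛ refl𝕍 m x y) ∘ᵛ v
reflect-low {m} σ {x} {y} t u v ix iy e = begin
  (ext σ ∘ᵛ t) ∘ᵛ u                        ≡⟨ ∘ᵛ-assoc (ext σ) t u ⟩
  ext σ ∘ᵛ (t ∘ᵛ u)                        ≡⟨ cong (ext σ ∘ᵛ_) e ⟩
  ext σ ∘ᵛ (refl𝕍 (suc m) x y ∘ᵛ v)        ≡⟨ ∘ᵛ-assoc (ext σ) (refl𝕍 (suc m) x y) v ⟨
  (ext σ ∘ᵛ refl𝕍 (suc m) x y) ∘ᵛ v        ≡⟨ cong (λ w → (ext σ ∘ᵛ w) ∘ᵛ v) (ext-refl ix iy) ⟨
  (ext σ ∘ᵛ ext (refl𝕍 m x y)) ∘ᵛ v        ≡⟨ cong (_∘ᵛ v) (ext-∘ σ (refl-bounded ix iy)) ⟨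
  ext (σ ∘ᵛ refl𝕍 m x y) ∘ᵛ v              ∎
  where open ≡-Reasoning

refl-top-∘-low : ∀ {m a b x} → Index m a → Index m b → Index (suc m) x →
  refl𝕍 (suc m) x (top m) ∘ᵛ refl𝕍 (suc m) a b ≡ refl𝕍 (suc m) a b ∘ᵛ refl𝕍 (suc m) (reflMap a b x) (top m)
refl-top-∘-low {m} {a} {b} {x} ia ib ix = sym (begin
  refl𝕍 (suc m) a b ∘ᵛ refl𝕍 (suc m) (reflMap a b x) (top m)
    ≡⟨ refl-conjugate (Index-reflMap ia⁺ ib⁺ ix) (Index-top m) ia⁺ ib⁺ ⟩
  refl𝕍 (suc m) (reflMap a b (reflMap a b x)) (reflMap a b (top m)) ∘ᵛ refl𝕍 (suc m) a b
    ≡⟨ cong₂ (λ y z → refl𝕍 (suc m) y z ∘ᵛ refl𝕍 (suc m) a b) (reflMap-involutive (Index⇒≢0 ia) (Index⇒≢0 ib) x) (reflMap-top ia ib) ⟩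
  refl𝕍 (suc m) x (top m) ∘ᵛ refl𝕍 (suc m) a b
    ∎)
  where
  open ≡-Reasoning
  ia⁺ : Index (suc m) a
  ia⁺ = Index-suc ia
  ib⁺ : Index (suc m) b
  ib⁺ = Index-suc ib

reflect-low-conjugate : ∀ {m} σ {a b x} → Index m a → Index m b → Index (suc m) x →
  (ext σ ∘ᵛ refl𝕍 (suc m) x (top m)) ∘ᵛ refl𝕍 (suc m) a b ≡ ext (σ ∘ᵛ refl𝕍 m a b) ∘ᵛ refl𝕍 (suc m) (reflMap a b x) (top m)
reflect-low-conjugate {m} σ {a} {b} {x} ia ib ix = reflect-low σ (refl𝕍 (suc m) x (top m)) (refl𝕍 (suc m) a b)
  (refl𝕍 (suc m) (reflMap a b x) (top m)) ia ib (refl-top-∘-low ia ib ix)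

-- A reflection in lower points fixes m + 1, so it leaves the trivial factor trivial.
cost-low : ∀ {m a b x} → Index m a → Index m b → Index (suc m) x → cost m (reflMap a b x) ≤ cost m x
cost-low {m} {a} {b} {x} ia ib ix with x ℤ.≟ top m
... | yes refl   = ℕP.≤-reflexive (cong (cost m) (reflMap-top ia ib))
... | no x≢top = cost-mono ix (Index-reflMap (Index-suc ia) (Index-suc ib) ix) x≢top

-- Two factors (a , n) and (b , n) are merged into (x , y)(z , n) with x and y smaller than n,
-- by conjugating one with the other except when b = −a.
module _ {m : ℕ} {σ : Vec ℤ m} {c : ℕ} (σ-sorted : Sorted≤ m σ c)
  (reflected : ∀ {x y} → Index m x → Index m y → Sorted≤ m (σ ∘ᵛ refl𝕍 m x y) (suc c)) where

  private
    R : ℤ → ℤ → Vec ℤ (suc m)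
    R = refl𝕍 (suc m)
    n : ℤ
    n = top m
    n# : Index (suc m) n
    n# = Index-top m
    -n# : Index (suc m) (ℤ.- n)
    -n# = Index-neg n n#

  merge : ∀ {a b x y z} → Index (suc m) a → Index m x → Index m y → Index (suc m) z → cost m z ≤ cost m a →
    R a n ∘ᵛ R b n ≡ R x y ∘ᵛ R z n → Sorted≤ (suc m) ((ext σ ∘ᵛ R a n) ∘ᵛ R b n) (suc (c + cost m a))
  merge {a} {b} {z = z} ia ix iy iz z≤a e = Sorted≤-resp (sym (reflect-low σ (R a n) (R b n) (R z n) ix iy e)) (Sorted≤-grow (reflected ix iy) iz z≤a)

  conjugate-top : ∀ {a b} → Index (suc m) a → Index (suc m) b → R a n ∘ᵛ R b n ≡ R (reflMap a n b) a ∘ᵛ R a n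
  conjugate-top {a} {b} ia ib = ≡-trans (refl-conjugate ib n# ia n#) (cong (λ y → R (reflMap a n b) y ∘ᵛ R a n) (reflMap-snd a n))

  conjugate-negtop : ∀ {a} → Index m a → R a n ∘ᵛ R (ℤ.- n) n ≡ R (ℤ.- a) a ∘ᵛ R a n
  conjugate-negtop {a} ia = ≡-trans (conjugate-top (Index-suc ia) -n#)
    (cong (λ x → R x a ∘ᵛ R a n) (reflMap-neg-snd a (Index⇒≢0 n#)))

  reflect-top : ∀ {a b} → Index (suc m) a → Index (suc m) b →
    Sorted≤ (suc m) ((ext σ ∘ᵛ R a n) ∘ᵛ R b n) (suc (c + cost m a))
  reflect-top {a} {b} ia ib with b ℤ.≟ a
  -- The two factors cancel, and the trivial factor (n , n) of cost 0 stands in their place.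
  ... | yes refl = Sorted≤-resp (sym cancel)
    (Sorted≤-weaken (ℕP.m≤n⇒m≤1+n (ℕP.+-monoʳ-≤ c (ℕP.≤-trans (ℕP.≤-reflexive (cost-top m)) z≤n)))
      (Sorted≤-grow σ-sorted n# ℕP.≤-refl))
    where
    cancel : (ext σ ∘ᵛ R a n) ∘ᵛ R a n ≡ ext σ ∘ᵛ R n n
    cancel = ≡-trans (∘ᵛ-assoc (ext σ) (R a n) (R a n))
      (cong (ext σ ∘ᵛ_) (≡-trans (refl-involutive ia n#) (sym (refl-diagonal n#))))
  ... | no b≢a with index-cases ia | index-cases ib
  -- Here (n , n) is the identity, so (b , n) is a new factor and the additional 1 pays for it.
  ...   | inj₁ refl | _ = Sorted≤-resp (sym absorb)
    (Sorted≤-weaken (ℕP.≤-trans (ℕP.≤-reflexive (ℕP.+-comm c 1)) (s≤s (ℕP.m≤m+n c _))) (Sorted≤-grow σ-sorted ib (cost≤1 m b)))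
    where
    absorb : (ext σ ∘ᵛ R n n) ∘ᵛ R b n ≡ ext σ ∘ᵛ R b n
    absorb = cong (_∘ᵛ R b n) (≡-trans (cong (ext σ ∘ᵛ_) (refl-diagonal n#)) (∘ᵛ-identityʳ (ext σ)))
  ...   | _ | inj₁ refl = Sorted≤-resp (sym absorb)
    (Sorted≤-weaken (ℕP.n≤1+n _) (Sorted≤-grow σ-sorted ia ℕP.≤-refl))
    where
    absorb : (ext σ ∘ᵛ R a n) ∘ᵛ R n n ≡ ext σ ∘ᵛ R a n
    absorb = ≡-trans (cong ((ext σ ∘ᵛ R a n) ∘ᵛ_) (refl-diagonal n#)) (∘ᵛ-identityʳ (ext σ ∘ᵛ R a n))
  ...   | inj₂ (inj₁ refl) | inj₂ (inj₁ refl) = contradiction refl b≢a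
  ...   | inj₂ (inj₂ ia′) | inj₂ (inj₁ refl) =
    merge {b = ℤ.- n} ia (Index-neg a ia′) ia′ ia ℕP.≤-refl (conjugate-negtop ia′)
  ...   | inj₂ (inj₁ refl) | inj₂ (inj₂ ib′) =
    -- Conjugation by (-n , n) turns (b , n) into (-b , n), so the product becomes (-b , n)(-n , n),
    -- the situation of the preceding case with -b in the role of a.
    merge {b = b} ia (subst (Index m) (sym (ℤP.neg-involutive b)) ib′) (Index-neg b ib′) (Index-neg b ib)
      (cost-mono ia (Index-neg b ib) (λ ())) (begin
        R (ℤ.- n) n ∘ᵛ R b n                          ≡⟨ conjugate-top ia ib ⟩
        R (reflMap (ℤ.- n) n b) (ℤ.- n) ∘ᵛ R (ℤ.- n) n  ≡⟨ cong (λ x → R x (ℤ.- n) ∘ᵛ R (ℤ.- n) n) fixed ⟩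
        R b (ℤ.- n) ∘ᵛ R (ℤ.- n) n                    ≡⟨ cong (_∘ᵛ R (ℤ.- n) n) (≡-trans (sym (refl-negate ib -n#)) (cong (R (ℤ.- b)) (ℤP.neg-involutive n))) ⟩
        R (ℤ.- b) n ∘ᵛ R (ℤ.- n) n                    ≡⟨ conjugate-negtop (Index-neg b ib′) ⟩
        R (ℤ.- ℤ.- b) (ℤ.- b) ∘ᵛ R (ℤ.- b) n          ∎)
    where
    open ≡-Reasoning
    fixed : reflMap (ℤ.- n) n b ≡ b
    fixed = reflMap-fixes (λ e → low≢-top ib′ (sym (neg-swap (sym e)))) (low≢top ib′ ∘ sym) (low≢top ib′ ∘ sym) (λ e → low≢-top ib′ (sym (neg-swap (sym e))))
  ...   | inj₂ (inj₂ ia′) | inj₂ (inj₂ ib′) with b ℤ.≟ ℤ.- a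
  -- Conjugation would produce (-n , a) here, which still moves n; the identity `reflMap-opposite`
  -- yields a lower reflection instead.
  ...     | yes refl = merge {b = b} ia (Index-neg a ia′) ia′ -n# (cost-mono ia -n# (low≢top ia′ ∘ sym))
    (refl∘refl-cong ia n# ib n# (Index-neg a ia) ia -n# n# (reflMap-opposite ia′))
  ...     | no b≢-a = merge {b = b} ia ib′ ia′ ia ℕP.≤-refl
    (≡-trans (conjugate-top ia ib) (cong (λ x → R x a ∘ᵛ R a n)
      (reflMap-fixes b≢a (low≢top ib′ ∘ sym) b≢-a (λ e → low≢-top ib′ (sym (neg-swap (sym e)))))))

  -- A reflection that moves n can be rewritten as (b , n). Any other one passes the factor (a , n)
  -- and acts on σ.
  reflect-any : ∀ {a x y} → Index (suc m) a → Index (suc m) x → Index (suc m) y →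
    Sorted≤ (suc m) ((ext σ ∘ᵛ R a n) ∘ᵛ R x y) (suc (c + cost m a))
  reflect-any {a} {x} {y} ia ix iy with index-cases ix | index-cases iy
  ... | _ | inj₁ refl = reflect-top ia ix
  ... | inj₁ refl | _ = Sorted≤-resp (cong ((ext σ ∘ᵛ R a n) ∘ᵛ_) (refl-symmetric iy ix)) (reflect-top ia iy)
  ... | _ | inj₂ (inj₁ refl) = Sorted≤-resp (cong ((ext σ ∘ᵛ R a n) ∘ᵛ_) (refl-negate ix -n#)) (reflect-top ia (Index-neg x ix))
  ... | inj₂ (inj₁ refl) | _ = Sorted≤-resp
    (cong ((ext σ ∘ᵛ R a n) ∘ᵛ_) (≡-trans (refl-symmetric (Index-neg y iy) n#) (refl-negate ix iy))) (reflect-top ia (Index-neg y iy))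
  ... | inj₂ (inj₂ ix′) | inj₂ (inj₂ iy′) = Sorted≤-resp (sym (reflect-low-conjugate σ ix′ iy′ ia))
    (Sorted≤-grow (reflected ix′ iy′) (Index-reflMap ix iy ia) (cost-low ix′ iy′ ia))

Sorted⇒Sorted≤ : ∀ {n σ w} → Sorted n σ w → Sorted≤ n σ (proj₂ w)
Sorted⇒Sorted≤ σ-sorted = _ , _ , σ-sorted , ℕP.≤-refl

-- In every case at most one reflection is handed down to the smaller group, so the additional 1 is
-- paid only once.
Sorted-reflect : ∀ {n σ w a b} → Sorted n σ w → Index n a → Index n b → Sorted≤ n (σ ∘ᵛ refl𝕍 n a b) (suc (proj₂ w))
Sorted-reflect Growth.empty ia ib = contradiction (ℕP.≤-trans (lower ia) (upper ia)) (λ ())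
Sorted-reflect {a = a} {b} (Growth.grow {m} {σ} {w} (s , p) σ-sorted) ia ib =
  Sorted≤-resp (cong (_∘ᵛ refl𝕍 (suc m) a b) (sym (displace-product s p σ)))
    (subst (λ k → Sorted≤ (suc m) ((ext σ ∘ᵛ refl𝕍 (suc m) (letter s (toℕ p)) (top m)) ∘ᵛ refl𝕍 (suc m) a b) (suc (proj₂ w + k))) (cost-letter (s , p))
      (reflect-any (Sorted⇒Sorted≤ σ-sorted) (Sorted-reflect σ-sorted) (Index-letter s p) ia ib))

-- Multiplication by (-1 , 1)

ρ : ∀ n → Vec ℤ n
ρ n = refl𝕍 n -[1+ 0 ] (+ 1)

index₁ : ∀ m → Index (suc m) (+ 1)
index₁ m = index (s≤s z≤n , s≤s z≤n)

index₋₁ : ∀ m → Index (suc m) -[1+ 0 ]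
index₋₁ m = index (s≤s z≤n , s≤s z≤n)

-- The factor (-1 , 1) passes every factor (a , n) with n > 1, at most negating a, until it reaches
-- B_1, where every element has length 0.
Sorted-ρ : ∀ {m σ w} → Sorted (suc m) σ w → Sorted≤ (suc m) (σ ∘ᵛ ρ (suc m)) (proj₂ w)
Sorted-ρ {σ = σ} b@(Growth.grow {zero} c Growth.empty) with Sorted-reflect b (index₋₁ 0) (index₁ 0)
... | s , c′ , b′ , _ = s , c′ , b′ , ℕP.≤-trans (ℕP.≤-reflexive (length-0 b′)) z≤n
  where
  length-0 : ∀ {σ w} → Sorted 1 σ w → proj₂ w ≡ 0
  length-0 (Growth.grow (s , p) Growth.empty) = ≡-trans (sym (cost-letter (s , p))) (cost-0 (Index-letter s p))
Sorted-ρ (Growth.grow {suc m} {σ} {w} (s , p) σ-sorted) =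
  Sorted≤-resp (cong (_∘ᵛ ρ (suc (suc m))) (sym (displace-product s p σ)))
    (Sorted≤-resp (sym (reflect-low-conjugate σ (index₋₁ m) (index₁ m) ia))
      (Sorted≤-grow (Sorted-ρ σ-sorted) (Index-reflMap (index₋₁ (suc m)) (index₁ (suc m)) ia)
        (subst (cost (suc m) (reflMap -[1+ 0 ] (+ 1) (letter s (toℕ p))) ≤_) (cost-letter (s , p)) (cost-low (index₋₁ m) (index₁ m) ia))))
  where
  ia : Index (suc (suc m)) (letter s (toℕ p))
  ia = Index-letter s p

-- Minimal words in T^D

-- As `top k` is k + 1, `plain` gives (a , j) with j = k + 1 and |a| < j, and `signed` gives (-i ,
-- i)(-1 , 1) with i = k + 2, hence i > 1.
data Generator (n : ℕ) : Vec ℤ n → Set where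
  plain  : ∀ {k a} → k < n → Index k a → Generator n (refl𝕍 n a (top k))
  signed : ∀ {k} → suc k < n → Generator n (refl𝕍 n -[1+ suc k ] (top (suc k)) ∘ᵛ ρ n)

plainWith : ∀ n → ℕ → List (Vec ℤ n)
plainWith n j = map (λ i → reflB n (i , j)) (points (j ∸ 1))

signedAt : ∀ n → ℕ → Vec ℤ n
signedAt n i = reflB n (-[1+ i ] , suc i) ∘ᵛ ρ n

-- The local list in `TD` unfolds to `points (j ∸ 1)`, so membership in T^D reduces to membership in
-- `points`.
TD-split : ∀ n → TD n ≡ concatMap (plainWith n) (map suc (upTo n)) ++ map (signedAt n) (map suc (upTo (n ∸ 1)))
TD-split n = refl

∈-TD⁺ : ∀ {n t} → Generator n t → t ∈ TD n
∈-TD⁺ {n} (plain {k} {a} k<n ia) = subst (refl𝕍 n a (top k) ∈_) (sym (TD-split n)) (∈P.∈-++⁺ˡ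
  (∈-concatMap⁺ (plainWith n) {suc k} (∈P.∈-map⁺ suc (∈P.∈-upTo⁺ k<n)) (∈P.∈-map⁺ (λ i → reflB n (i , suc k)) {a} (∈-points⁺ (Index.inRange ia)))))
∈-TD⁺ {suc n} (signed {k} (s≤s k<n)) = subst (signedAt (suc n) (suc k) ∈_) (sym (TD-split (suc n)))
  (∈P.∈-++⁺ʳ (concatMap (plainWith (suc n)) (map suc (upTo (suc n))))
    (∈P.∈-map⁺ (signedAt (suc n)) {suc k} (∈P.∈-map⁺ suc (∈P.∈-upTo⁺ k<n))))

∈-TD⁻ : ∀ {n t} → t ∈ TD n → Generator n t
∈-TD⁻ {n} {t} t∈ with ∈P.∈-++⁻ (concatMap (plainWith n) (map suc (upTo n))) (subst (t ∈_) (TD-split n) t∈)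
... | inj₁ t∈ˡ with ∈-concatMap⁻ (plainWith n) (map suc (upTo n)) t∈ˡ
...   | j , j∈ , t∈ʲ with ∈P.∈-map⁻ suc j∈
...     | k , k∈ , refl with ∈P.∈-map⁻ (λ i → reflB n (i , suc k)) t∈ʲ
...       | a , a∈ , refl = plain {a = a} (∈P.∈-upTo⁻ k∈) (index (∈-points⁻ a∈))
∈-TD⁻ {n} t∈ | inj₂ t∈ʳ with ∈P.∈-map⁻ (signedAt n) t∈ʳ
...   | i , i∈ , refl with ∈P.∈-map⁻ suc i∈
...     | k , k∈ , refl = signed (suc-< n (∈P.∈-upTo⁻ k∈))
  where
  suc-< : ∀ n {k} → k < n ∸ 1 → suc k < n
  suc-< (suc n) k<n = s≤s k<n

Index-weaken : ∀ {k n a} → k ≤ n → Index k a → Index n a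
Index-weaken k≤n (index (l , u)) = index (l , ℕP.≤-trans u k≤n)

Index-top< : ∀ {k n} → k < n → Index n (top k)
Index-top< k<n = index (s≤s z≤n , k<n)

Index-negtop< : ∀ {k n} → k < n → Index n -[1+ k ]
Index-negtop< k<n = index (s≤s z≤n , k<n)

ρ-bounded : ∀ m → Bounded (suc m) (ρ (suc m))
ρ-bounded m = refl-bounded (index₋₁ m) (index₁ m)

Generator-bounded : ∀ {n t} → Generator n t → Bounded n t
Generator-bounded (plain k<n ia) = refl-bounded (Index-weaken (ℕP.<⇒≤ k<n) ia) (Index-top< k<n)
Generator-bounded {suc n} (signed {k} k<n) = ∘ᵛ-bounded (refl-bounded (Index-negtop< k<n) (Index-top< k<n)) (ρ (suc n))

ext-ρ : ∀ {m} (σ : Vec ℤ (suc m)) → ext (σ ∘ᵛ ρ (suc m)) ≡ ext σ ∘ᵛ ρ (suc (suc m))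
ext-ρ {m} σ = ≡-trans (ext-∘ σ (ρ-bounded m)) (cong (ext σ ∘ᵛ_) (ext-refl (index₋₁ m) (index₁ m)))

Generator-ext : ∀ {m t} → Generator m t → Generator (suc m) (ext t)
Generator-ext {m} (plain {k} {a} k<m ia) = subst (Generator (suc m)) (sym (ext-refl (Index-weaken (ℕP.<⇒≤ k<m) ia) (Index-top< k<m)))
  (plain (ℕP.m≤n⇒m≤1+n k<m) ia)
Generator-ext {suc m} (signed {k} k<m) = subst (Generator (suc (suc m)))
  (sym (≡-trans (ext-ρ (refl𝕍 (suc m) -[1+ suc k ] (top (suc k))))
         (cong (_∘ᵛ ρ (suc (suc m))) (ext-refl (Index-negtop< k<m) (Index-top< k<m)))))
  (signed (ℕP.m≤n⇒m≤1+n k<m))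

prodᵛ-bounded : ∀ {n ts} → All (Bounded n) ts → Bounded n (prodᵛ ts)
prodᵛ-bounded {n} []                  = id-bounded n
prodᵛ-bounded {ts = _ ∷ ts} (bd ∷ bds) = ∘ᵛ-bounded bd (prodᵛ ts)

prodᵛ-∷ʳ : ∀ {n} ts {t : Vec ℤ n} → Bounded n t → prodᵛ (ts ++ t ∷ []) ≡ prodᵛ ts ∘ᵛ t
prodᵛ-∷ʳ []       {t} bd = ≡-trans (∘ᵛ-identityʳ t) (sym (∘ᵛ-identityˡ bd))
prodᵛ-∷ʳ (u ∷ ts) {t} bd = ≡-trans (cong (u ∘ᵛ_) (prodᵛ-∷ʳ ts bd)) (sym (∘ᵛ-assoc u (prodᵛ ts) t))

prodᵛ-ext : ∀ {m ts} → All (Bounded m) ts → prodᵛ (map ext ts) ≡ ext (prodᵛ ts)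
prodᵛ-ext {m} []                  = sym (ext-id m)
prodᵛ-ext {ts = t ∷ ts} (bd ∷ bds) = ≡-trans (cong (ext t ∘ᵛ_) (prodᵛ-ext bds)) (sym (ext-∘ t (prodᵛ-bounded bds)))

Sorted-generator : ∀ {n σ w t} → Sorted n σ w → Generator n t → Sorted≤ n (σ ∘ᵛ t) (suc (proj₂ w))
Sorted-generator b (plain k<n ia) = Sorted-reflect b (Index-weaken (ℕP.<⇒≤ k<n) ia) (Index-top< k<n)
Sorted-generator {suc n} {σ} b (signed {k} k<n) with Sorted-reflect b (Index-negtop< k<n) (Index-top< k<n)
... | _ , _ , b′ , c′≤ with Sorted-ρ b′
...   | s , c″ , b″ , c″≤ = s , c″ ,
  subst (λ τ → Sorted (suc n) τ (s , c″)) (∘ᵛ-assoc σ (refl𝕍 (suc n) -[1+ suc k ] (top (suc k))) (ρ (suc n))) b″ ,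
  ℕP.≤-trans c″≤ c′≤

Sorted-word : ∀ {n σ w ts} → Sorted n σ w → All (Generator n) ts → Sorted≤ n (σ ∘ᵛ prodᵛ ts) (proj₂ w + length ts)
Sorted-word {σ = σ} {w} b [] = Sorted≤-resp (sym (∘ᵛ-identityʳ σ)) (Sorted≤-weaken (ℕP.m≤m+n (proj₂ w) 0) (Sorted⇒Sorted≤ b))
Sorted-word {σ = σ} {w} {t ∷ ts} b (g ∷ gs) with Sorted-generator b g
... | s , c , b′ , c≤ = Sorted≤-resp (∘ᵛ-assoc σ t (prodᵛ ts))
  (Sorted≤-weaken (ℕP.≤-trans (ℕP.+-monoˡ-≤ (length ts) c≤) (ℕP.≤-reflexive (sym (ℕP.+-suc (proj₂ w) (length ts)))))
    (Sorted-word b′ gs))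

Sorted-id : ∀ n → Sorted≤ n (idᵛ n) 0
Sorted-id zero    = 0 , 0 , Growth.empty , z≤n
Sorted-id (suc m) = Sorted≤-resp
  (≡-trans (cong (ext (idᵛ m) ∘ᵛ_) (refl-diagonal (Index-top m))) (≡-trans (∘ᵛ-identityʳ _) (ext-id m)))
  (Sorted≤-grow (Sorted-id m) (Index-top m) (ℕP.≤-reflexive (cost-top m)))

-- Multiplying the identity by the elements of the word one after another produces a growth history
-- of σ with length at most that of the word. Histories of σ agree in their monomial, so the bound
-- holds for the given one.
word-length≥ : ∀ {n σ w ts} → Sorted n σ w → All (Generator n) ts → prodᵛ ts ≡ σ → proj₂ w ≤ length ts
word-length≥ {n} {ts = ts} b gs refl with Sorted-id n
... | _ , _ , b₀ , c≤0 with Sorted-word b₀ gs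
...   | _ , _ , b′ , c′≤ = subst (_≤ length ts) (cong proj₂ (Sorting.Built-functional (subst (λ σ → Sorted n σ _) id∘ b′) b))
  (ℕP.≤-trans c′≤ (ℕP.+-monoˡ-≤ (length ts) c≤0))
  where
  id∘ : idᵛ n ∘ᵛ prodᵛ ts ≡ prodᵛ ts
  id∘ = ∘ᵛ-identityˡ (prodᵛ-bounded (All.map Generator-bounded gs))

-- A word for σ itself if σ lies in D_n, and for σ (−1 , 1) otherwise.
twist : ∀ {n} → Bool → Vec ℤ n → Vec ℤ n
twist         true  σ = σ
twist {n = n} false σ = σ ∘ᵛ ρ n

isLast-true : ∀ {m} (p : Fin (suc m)) → isLast p ≡ true → toℕ p ≡ m
isLast-true {zero}  zero    _ = refl
isLast-true {suc m} (suc p) e = cong suc (isLast-true p e)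

isLast-false : ∀ {m} (p : Fin (suc m)) → isLast p ≡ false → toℕ p < m
isLast-false {suc m} zero    _ = s≤s z≤n
isLast-false {suc m} (suc p) e = s≤s (isLast-false p e)

∧-falseʳ : ∀ b → b ∧ false ≡ false
∧-falseʳ true  = refl
∧-falseʳ false = refl

-- Formulated on all of B_n, since the history of an element of D_n may pass through words of odd
-- parity.
record SignedWord {n} (σ : Vec ℤ n) (c : ℕ) : Set where
  constructor signedWord
  field
    word       : List (Vec ℤ n)
    generators : All (Generator n) word
    length≡    : length word ≡ c
    product    : prodᵛ word ≡ twist (evenNeg σ) σ

ext-twist : ∀ {m} b (σ : Vec ℤ (suc m)) → ext (twist b σ) ≡ twist b (ext σ)
ext-twist true  σ = refl
ext-twist false σ = ext-ρ σ

SignedWord-ext-id : ∀ {m} {σ : Vec ℤ (suc m)} {τ c} → τ ≡ ext σ → evenNeg τ ≡ evenNeg σ → SignedWord σ c → SignedWord τ c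
SignedWord-ext-id {σ = σ} refl e (signedWord ts gs refl prod) = signedWord (map ext ts) (AllP.map⁺ (All.map Generator-ext gs)) (ListP.length-map ext ts)
  (≡-trans (prodᵛ-ext (All.map Generator-bounded gs)) (≡-trans (cong ext prod) (≡-trans (ext-twist (evenNeg σ) σ) (cong (λ b → twist b (ext σ)) (sym e)))))

SignedWord-∷ʳ : ∀ {m} {σ : Vec ℤ (suc m)} {τ c t} → Generator (suc (suc m)) t →
  twist (evenNeg σ) (ext σ) ∘ᵛ t ≡ twist (evenNeg τ) τ → SignedWord σ c → SignedWord τ (c + 1)
SignedWord-∷ʳ {m} {σ} {τ} {t = t} g e (signedWord ts gs refl prod) = signedWord (map ext ts ++ t ∷ []) (AllP.++⁺ (AllP.map⁺ (All.map Generator-ext gs)) (g ∷ []))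
  (≡-trans (ListP.length-++ (map ext ts)) (cong (_+ 1) (ListP.length-map ext ts))) (begin
    prodᵛ (map ext ts ++ t ∷ [])     ≡⟨ prodᵛ-∷ʳ (map ext ts) (Generator-bounded g) ⟩
    prodᵛ (map ext ts) ∘ᵛ t          ≡⟨ cong (_∘ᵛ t) (prodᵛ-ext (All.map Generator-bounded gs)) ⟩
    ext (prodᵛ ts) ∘ᵛ t              ≡⟨ cong (λ υ → ext υ ∘ᵛ t) prod ⟩
    ext (twist b σ) ∘ᵛ t             ≡⟨ cong (_∘ᵛ t) (ext-twist b σ) ⟩
    twist b (ext σ) ∘ᵛ t             ≡⟨ e ⟩
    twist (evenNeg τ) τ              ∎)
  where
  open ≡-Reasoning
  b : Bool
  b = evenNeg σ

sorted-word : ∀ {n σ w} → Sorted n σ w → SignedWord σ (proj₂ w)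
sorted-word Growth.empty = signedWord [] [] refl refl
sorted-word (Growth.grow {zero} (Sign.+ , zero) Growth.empty) = signedWord [] [] refl refl
-- The twist of the word -1 by (-1 , 1) is the identity, so the empty word serves.
sorted-word (Growth.grow {zero} (Sign.- , zero) Growth.empty) = signedWord [] [] refl refl
sorted-word (Growth.grow {suc m} {σ} {w} (s , p) b) = go s (isLast p) refl
  where
  open ≡-Reasoning
  n : ℕ
  n = suc (suc m)
  R : ℤ → Vec ℤ n
  R a = refl𝕍 n a (top (suc m))
  IH : SignedWord σ (proj₂ w)
  IH = sorted-word b
  τ : Sign → Vec ℤ n
  τ s = displace s (letter s (suc m)) p σ
  parity : ∀ s {l} → isLast p ≡ l → evenNeg (τ s) ≡ (isNegative s ∧ l) xor evenNeg σ
  parity s refl = Scheme.evenNeg-step sorting (s , p) (Sorting.Built⇒Signed b)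
  Goal : Sign → Set
  Goal s = SignedWord (τ s) (proj₂ w + 1 ⊓ degree (suc m) (s , p))
  ρ-commutes : R -[1+ suc m ] ∘ᵛ ρ n ≡ ρ n ∘ᵛ R -[1+ suc m ]
  ρ-commutes = ≡-trans (refl-top-∘-low (index₋₁ m) (index₁ m) (Index-neg (top (suc m)) (Index-top (suc m))))
    (cong (λ a → ρ n ∘ᵛ R a) (≡-trans (reflMap-neg { -[1+ 0 ]} {+ 1} (λ ()) (λ ()) (top (suc m))) (cong ℤ.-_ (reflMap-top (index₋₁ m) (index₁ m)))))
  go : ∀ s l → isLast p ≡ l → Goal s
  go Sign.+ true e = subst (SignedWord (τ Sign.+)) cost-0′ (SignedWord-ext-id (τ≡) (parity Sign.+ e) IH)
    where
    p≡ : toℕ p ≡ suc m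
    p≡ = isLast-true p e
    cost-0′ : proj₂ w ≡ proj₂ w + 1 ⊓ (suc m ∸ toℕ p)
    cost-0′ = sym (≡-trans (cong (λ k → proj₂ w + 1 ⊓ (suc m ∸ k)) p≡) (≡-trans (cong (λ k → proj₂ w + 1 ⊓ k) (ℕP.n∸n≡0 m)) (ℕP.+-identityʳ _)))
    τ≡ : τ Sign.+ ≡ ext σ
    τ≡ = begin
      τ Sign.+                         ≡⟨ displace-product Sign.+ p σ ⟩
      ext σ ∘ᵛ R (+ suc (toℕ p))       ≡⟨ cong (λ k → ext σ ∘ᵛ R (+ suc k)) p≡ ⟩
      ext σ ∘ᵛ R (top (suc m))         ≡⟨ cong (ext σ ∘ᵛ_) (refl-diagonal (Index-top (suc m))) ⟩
      ext σ ∘ᵛ idᵛ n                   ≡⟨ ∘ᵛ-identityʳ (ext σ) ⟩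
      ext σ                            ∎
  -- The factor (-n , n) changes the parity, so σ and the new word never need the same twist; the
  -- factor (-1 , 1) in the generator makes up for this.
  go Sign.- true e = SignedWord-∷ʳ (signed ℕP.≤-refl) (≡-trans (prod (evenNeg σ)) (cong (λ b → twist b (τ Sign.-)) (sym (parity Sign.- e)))) IH
    where
    N : Vec ℤ n
    N = R -[1+ suc m ]
    τ≡ : τ Sign.- ≡ ext σ ∘ᵛ N
    τ≡ = ≡-trans (displace-product Sign.- p σ) (cong (λ k → ext σ ∘ᵛ R -[1+ k ]) (isLast-true p e))
    prod : ∀ b → twist b (ext σ) ∘ᵛ (N ∘ᵛ ρ n) ≡ twist (not b) (τ Sign.-)
    prod true = begin
      ext σ ∘ᵛ (N ∘ᵛ ρ n)            ≡⟨ ∘ᵛ-assoc (ext σ) N (ρ n) ⟨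
      (ext σ ∘ᵛ N) ∘ᵛ ρ n            ≡⟨ cong (_∘ᵛ ρ n) τ≡ ⟨
      τ Sign.- ∘ᵛ ρ n                ∎
    prod false = begin
      (ext σ ∘ᵛ ρ n) ∘ᵛ (N ∘ᵛ ρ n)   ≡⟨ cong ((ext σ ∘ᵛ ρ n) ∘ᵛ_) ρ-commutes ⟩
      (ext σ ∘ᵛ ρ n) ∘ᵛ (ρ n ∘ᵛ N)   ≡⟨ ∘ᵛ-assoc (ext σ) (ρ n) (ρ n ∘ᵛ N) ⟩
      ext σ ∘ᵛ (ρ n ∘ᵛ (ρ n ∘ᵛ N))   ≡⟨ cong (ext σ ∘ᵛ_) (∘ᵛ-assoc (ρ n) (ρ n) N) ⟨
      ext σ ∘ᵛ ((ρ n ∘ᵛ ρ n) ∘ᵛ N)   ≡⟨ cong (λ υ → ext σ ∘ᵛ (υ ∘ᵛ N)) (refl-involutive (index₋₁ (suc m)) (index₁ (suc m))) ⟩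
      ext σ ∘ᵛ (idᵛ n ∘ᵛ N)          ≡⟨ cong (ext σ ∘ᵛ_) (∘ᵛ-identityˡ (refl-bounded (Index-negtop< ℕP.≤-refl) (Index-top (suc m)))) ⟩
      ext σ ∘ᵛ N                     ≡⟨ τ≡ ⟨
      τ Sign.-                       ∎
  go s false e = subst (SignedWord (τ s)) (cong (_+_ (proj₂ w)) (sym (cost-1 s)))
    (low-word (evenNeg σ) refl)
    where
    a : ℤ
    a = letter s (toℕ p)
    p<m : toℕ p < suc m
    p<m = isLast-false p e
    ia : Index (suc m) a
    ia = index (subst (InRange (suc m)) (sym (∣letter∣ s (toℕ p))) (s≤s z≤n , p<m))
    cost-1 : ∀ s → 1 ⊓ degree (suc m) (s , p) ≡ 1
    cost-1 Sign.+ = ℕP.m≤n⇒m⊓n≡m (ℕP.m<n⇒0<n∸m p<m)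
    cost-1 Sign.- = refl
    same : evenNeg (τ s) ≡ evenNeg σ
    same = ≡-trans (parity s e) (cong (_xor evenNeg σ) (∧-falseʳ (isNegative s)))
    low-word : ∀ b → evenNeg σ ≡ b → SignedWord (τ s) (proj₂ w + 1)
    low-word true eσ = SignedWord-∷ʳ (plain ℕP.≤-refl ia) (begin
      twist (evenNeg σ) (ext σ) ∘ᵛ R a      ≡⟨ cong (λ b → twist b (ext σ) ∘ᵛ R a) eσ ⟩
      ext σ ∘ᵛ R a                          ≡⟨ displace-product s p σ ⟨
      twist true (τ s)                      ≡⟨ cong (λ b → twist b (τ s)) (≡-trans same eσ) ⟨
      twist (evenNeg (τ s)) (τ s)           ∎) IH
    -- The twist of σ stands in front of the new factor. Moving it to the end replaces a by its
    -- image under (-1 , 1), which is why the generator is chosen with `a′`.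
    low-word false eσ = SignedWord-∷ʳ (plain ℕP.≤-refl (Index-reflMap (index₋₁ m) (index₁ m) ia)) (begin
      twist (evenNeg σ) (ext σ) ∘ᵛ R a′     ≡⟨ cong (λ b → twist b (ext σ) ∘ᵛ R a′) eσ ⟩
      (ext σ ∘ᵛ ρ n) ∘ᵛ R a′                ≡⟨ ∘ᵛ-assoc (ext σ) (ρ n) (R a′) ⟩
      ext σ ∘ᵛ (ρ n ∘ᵛ R a′)                ≡⟨ cong (ext σ ∘ᵛ_) (refl-top-∘-low (index₋₁ m) (index₁ m) (Index-suc ia)) ⟨
      ext σ ∘ᵛ (R a ∘ᵛ ρ n)                 ≡⟨ ∘ᵛ-assoc (ext σ) (R a) (ρ n) ⟨
      (ext σ ∘ᵛ R a) ∘ᵛ ρ n                 ≡⟨ cong (_∘ᵛ ρ n) (displace-product s p σ) ⟨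
      twist false (τ s)                     ≡⟨ cong (λ b → twist b (τ s)) (≡-trans same eσ) ⟨
      twist (evenNeg (τ s)) (τ s)           ∎) IH
      where
      a′ : ℤ
      a′ = reflMap -[1+ 0 ] (+ 1) a

-- The search for a shortest word

∈-allWords⁺ : ∀ {A : Set} {xs : List A} {ts} → All (_∈ xs) ts → ts ∈ allWords xs (length ts)
∈-allWords⁺ [] = here refl
∈-allWords⁺ {xs = xs} {t ∷ ts} (t∈ ∷ ts∈) =
  ∈-concatMap⁺ (λ x → map (x ∷_) (allWords xs (length ts))) t∈ (∈P.∈-map⁺ (t ∷_) (∈-allWords⁺ ts∈))

∈-allWords⁻ : ∀ {A : Set} {xs : List A} k {ts} → ts ∈ allWords xs k → All (_∈ xs) ts × length ts ≡ k
∈-allWords⁻ zero (here refl) = [] , refl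
∈-allWords⁻ {xs = xs} (suc k) ts∈ with ∈-concatMap⁻ (λ x → map (x ∷_) (allWords xs k)) xs ts∈
... | x , x∈ , ts∈′ with ∈P.∈-map⁻ (x ∷_) ts∈′
... | us , us∈ , refl with ∈-allWords⁻ k us∈
... | us-all , refl = x∈ ∷ us-all , refl

prodOfLen⁺ : ∀ {n} {σ : Vec ℤ n} {ts} → All (Generator n) ts → prodᵛ ts ≡ σ → T (prodOfLen σ (length ts))
prodOfLen⁺ {σ = σ} gs e = AnyP.any⁺ (λ w → prodᵛ w ==ᵛ σ) (lose (∈-allWords⁺ (All.map ∈-TD⁺ gs)) (fromWitness e))

prodOfLen⁻ : ∀ {n} {σ : Vec ℤ n} k → T (prodOfLen σ k) → ∃ λ ts → All (Generator n) ts × length ts ≡ k × prodᵛ ts ≡ σ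
prodOfLen⁻ {n} {σ} k t with find (AnyP.any⁻ (λ w → prodᵛ w ==ᵛ σ) (allWords (TD n) k) t)
... | ts , ts∈ , e with ∈-allWords⁻ k ts∈
... | ts-all , refl = ts , All.map ∈-TD⁻ ts-all , refl , toWitness e

searchFrom-minimal : ∀ {n} (σ : Vec ℤ n) {c} → T (prodOfLen σ c) → (∀ k → T (prodOfLen σ k) → c ≤ k) →
  ∀ m fuel → m ≤ c → c ≤ m + fuel → searchFrom σ m fuel ≡ c
searchFrom-minimal σ {c} found min m zero m≤c c≤ = ℕP.≤-antisym m≤c (subst (c ≤_) (ℕP.+-identityʳ m) c≤)
searchFrom-minimal σ {c} found min m (suc fuel) m≤c c≤ with prodOfLen σ m in eq
... | true  = ℕP.≤-antisym m≤c (min m (Equivalence.from T-≡ eq))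
... | false = searchFrom-minimal σ found min (suc m) fuel
  (ℕP.≤∧≢⇒< m≤c (λ { refl → subst T eq found })) (subst (c ≤_) (ℕP.+-suc m fuel) c≤)

-- Each growth step adds at most one factor. Together with `n≤[2n]^n` this places the length within
-- the search bound of `lD'`.
sorted-length≤ : ∀ {n σ w} → Sorted n σ w → proj₂ w ≤ n
sorted-length≤ Growth.empty = z≤n
sorted-length≤ (Growth.grow {m} {w = w} c b) =
  ℕP.≤-trans (ℕP.+-mono-≤ (sorted-length≤ b) (ℕP.m⊓n≤m 1 (degree m c))) (ℕP.≤-reflexive (ℕP.+-comm m 1))

n≤[2n]^n : ∀ n → n ≤ (2 * n) ℕ.^ n
n≤[2n]^n zero    = z≤n
n≤[2n]^n n@(suc m) = ℕP.≤-trans (ℕP.m≤m+n n (1 * n))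
  (ℕP.≤-trans (ℕP.≤-reflexive (sym (ℕP.^-identityʳ (2 * n)))) (ℕP.^-monoʳ-≤ (2 * n) (s≤s (z≤n {m}))))

lD'-sorted : ∀ {n σ w} → Sorted n σ w → T (evenNeg σ) → lD' σ ≡ proj₂ w
lD'-sorted {n} {σ} {w} b ev with sorted-word b
... | signedWord ts gs e prod = searchFrom-minimal σ
  (subst (T ∘ prodOfLen σ) e (prodOfLen⁺ gs (≡-trans prod (cong (λ b → twist b σ) (Equivalence.to T-≡ ev)))))
  minimal 0 ((2 * n) ℕ.^ n) z≤n (ℕP.≤-trans (sorted-length≤ b) (n≤[2n]^n n))
  where
  minimal : ∀ k → T (prodOfLen σ k) → proj₂ w ≤ k
  minimal k t with prodOfLen⁻ k t
  ... | us , us-gs , refl , us-prod = word-length≥ b us-gs us-prod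

-- Factorizations with increasing indices

-- With p counted from 0 and s = -, the term j - i - 2 is (m + 1) + (p + 1) - 2 = m + p.
degree-sorTerm : ∀ {m} (c : Choice m) → degree m c ≡ sorTerm (letter (proj₁ c) (toℕ (proj₂ c)) , suc m)
degree-sorTerm (Sign.+ , p) = refl
degree-sorTerm {m} (Sign.- , p) = cong (_∸ 1) (sym (ℕP.+-suc m (toℕ p)))

Sorted-resp : ∀ {n σ τ d d′ c} → σ ≡ τ → d ≡ d′ → Sorted n σ (d , c) → Sorted n τ (d′ , c)
Sorted-resp refl refl b = b

Sorted-grow : ∀ {m σ w a} → Sorted m σ w → Index (suc m) a →
  ∃ λ c → Sorted (suc m) (ext σ ∘ᵛ refl𝕍 (suc m) a (top m)) (proj₁ w + sorTerm (a , suc m) , c)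
Sorted-grow {m} {σ} {w} b ia with Index⇒letter ia
... | s , p , refl = _ ,
  Sorted-resp (displace-product s p σ) (cong (_+_ (proj₁ w)) (degree-sorTerm (s , p))) (Growth.grow (s , p) b)

Factor : ℕ → ℤ × ℕ → Set
Factor n (i , j) = Index n i × Index n (+ j)

evaluate : ∀ n → List (ℤ × ℕ) → Vec ℤ n
evaluate n f = prodᵛ (map (reflB n) f)

evaluate-bounded : ∀ {n f} → All (Factor n) f → All (Bounded n) (map (reflB n) f)
evaluate-bounded fs = AllP.map⁺ (All.map (λ (i , j) → refl-bounded i j) fs)

evaluate-ext : ∀ {m f} → All (Factor m) f → evaluate (suc m) f ≡ ext (evaluate m f)
evaluate-ext {m} {f} fs = ≡-trans (cong prodᵛ (reflections fs)) (prodᵛ-ext (evaluate-bounded fs))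
  where
  reflections : ∀ {f} → All (Factor m) f → map (reflB (suc m)) f ≡ map ext (map (reflB m) f)
  reflections []              = refl
  reflections ((i , j) ∷ fs) = cong₂ _∷_ (sym (ext-refl i j)) (reflections fs)

∈-firstB⁻ : ∀ {m a} → a ∈ firstB (suc m) → Index (suc m) a
∈-firstB⁻ {m} a∈ with ∈P.∈-++⁻ (map (λ k → -[1+ k ]) (upTo (suc m))) a∈
... | inj₁ a∈ˡ with ∈P.∈-map⁻ (λ k → -[1+ k ]) a∈ˡ
...   | k , k∈ , refl = Index-negtop< (∈P.∈-upTo⁻ k∈)
∈-firstB⁻ {m} a∈ | inj₂ a∈ʳ with ∈P.∈-map⁻ (λ k → + suc k) a∈ʳ
...   | k , k∈ , refl = Index-top< (ℕP.m≤n⇒m≤1+n (∈P.∈-upTo⁻ k∈))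

∈-firstB⁺ : ∀ {m a} → Index (suc m) a → a ≢ top m → a ∈ firstB (suc m)
∈-firstB⁺ {m} {+ zero}   (index (() , _)) _
∈-firstB⁺ {m} {+ suc k}  (index (_ , k<)) ≢ = ∈P.∈-++⁺ʳ (map (λ k → -[1+ k ]) (upTo (suc m)))
  (∈P.∈-map⁺ (λ k → + suc k) (∈P.∈-upTo⁺ (ℕP.≤∧≢⇒< (ℕP.≤-pred k<) (λ e → ≢ (cong (λ k → + suc k) e)))))
∈-firstB⁺ {m} { -[1+ k ]} (index (_ , k<)) ≢ = ∈P.∈-++⁺ˡ (∈P.∈-map⁺ (λ k → -[1+ k ]) (∈P.∈-upTo⁺ k<))

appendFactor : ∀ m → List (ℤ × ℕ) → List (List (ℤ × ℕ))
appendFactor m f = map (λ i → f ++ ((i , suc m) ∷ [])) (firstB (suc m))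

data Extends m (g : List (ℤ × ℕ)) : Set where
  keeps   : g ∈ incFacts m → Extends m g
  appends : ∀ {f a} → f ∈ incFacts m → Index (suc m) a → g ≡ f ++ (a , suc m) ∷ [] → Extends m g

∈-incFacts⁻ : ∀ {m g} → g ∈ incFacts (suc m) → Extends m g
∈-incFacts⁻ {m} g∈ with ∈P.∈-++⁻ (incFacts m) g∈
... | inj₁ g∈ˡ = keeps g∈ˡ
... | inj₂ g∈ʳ with ∈-concatMap⁻ (appendFactor m) (incFacts m) g∈ʳ
...   | f , f∈ , g∈′ with ∈P.∈-map⁻ (λ i → f ++ ((i , suc m) ∷ [])) g∈′
...     | a , a∈ , e = appends f∈ (∈-firstB⁻ a∈) e

incFacts-factors : ∀ n {f} → f ∈ incFacts n → All (Factor n) f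
incFacts-factors zero    (here refl) = []
incFacts-factors (suc m) g∈ with ∈-incFacts⁻ {m} g∈
... | keeps g∈′ = All.map (λ (i , j) → Index-suc i , Index-suc j) (incFacts-factors m g∈′)
... | appends f∈ ia refl = AllP.++⁺ (All.map (λ (i , j) → Index-suc i , Index-suc j) (incFacts-factors m f∈)) ((ia , Index-top m) ∷ [])

evaluate-∷ʳ : ∀ {m f a} → All (Factor m) f → Index (suc m) a →
  evaluate (suc m) (f ++ (a , suc m) ∷ []) ≡ ext (evaluate m f) ∘ᵛ refl𝕍 (suc m) a (top m)
evaluate-∷ʳ {m} {f} {a} fs ia = begin
  prodᵛ (map (reflB (suc m)) (f ++ (a , suc m) ∷ []))              ≡⟨ cong prodᵛ (ListP.map-++ (reflB (suc m)) f _) ⟩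
  prodᵛ (map (reflB (suc m)) f ++ refl𝕍 (suc m) a (top m) ∷ [])    ≡⟨ prodᵛ-∷ʳ (map (reflB (suc m)) f) (refl-bounded ia (Index-top m)) ⟩
  evaluate (suc m) f ∘ᵛ refl𝕍 (suc m) a (top m)                    ≡⟨ cong (_∘ᵛ refl𝕍 (suc m) a (top m)) (evaluate-ext fs) ⟩
  ext (evaluate m f) ∘ᵛ refl𝕍 (suc m) a (top m)                    ∎
  where open ≡-Reasoning

ext-∘-refl-top : ∀ {m} (σ : Vec ℤ m) → ext σ ∘ᵛ refl𝕍 (suc m) (top m) (top m) ≡ ext σ
ext-∘-refl-top {m} σ = ≡-trans (cong (ext σ ∘ᵛ_) (refl-diagonal (Index-top m))) (∘ᵛ-identityʳ (ext σ))

evaluate-sorted : ∀ n {f} → f ∈ incFacts n → ∃ λ c → Sorted n (evaluate n f) (sum (map sorTerm f) , c)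
evaluate-sorted zero (here refl) = 0 , Growth.empty
evaluate-sorted (suc m) {g} g∈ with ∈-incFacts⁻ {m} g∈
-- A list without a factor for m + 1 corresponds to growth by (m + 1 , m + 1), which is the identity
-- and contributes 0 to the sum.
... | keeps g∈′ with Sorted-grow (proj₂ (evaluate-sorted m g∈′)) (Index-top m)
...   | c , b = c , Sorted-resp
  (≡-trans (ext-∘-refl-top (evaluate m g)) (sym (evaluate-ext (incFacts-factors m g∈′))))
  (≡-trans (cong (_+_ (sum (map sorTerm g))) (ℕP.n∸n≡0 m)) (ℕP.+-identityʳ _)) b
evaluate-sorted (suc m) {g} g∈ | appends {f} {a} f∈ ia refl with Sorted-grow (proj₂ (evaluate-sorted m f∈)) ia
...   | c , b = c , Sorted-resp (sym (evaluate-∷ʳ (incFacts-factors m f∈) ia)) (sym sum-∷ʳ) b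
  where
  sum-∷ʳ : sum (map sorTerm (f ++ (a , suc m) ∷ [])) ≡ sum (map sorTerm f) + sorTerm (a , suc m)
  sum-∷ʳ = ≡-trans (cong sum (ListP.map-++ sorTerm f _)) (≡-trans (SumP.sum-++ (map sorTerm f) _)
    (cong (_+_ (sum (map sorTerm f))) (ℕP.+-identityʳ _)))

sorted-factorization : ∀ {n σ w} → Sorted n σ w → ∃ λ f → f ∈ incFacts n × evaluate n f ≡ σ
sorted-factorization Growth.empty = [] , here refl , refl
sorted-factorization (Growth.grow {m} {σ} (s , p) b) with sorted-factorization b | letter s (toℕ p) ℤ.≟ top m
... | f , f∈ , refl | yes e = f , ∈P.∈-++⁺ˡ f∈ , (begin
  evaluate (suc m) f                                      ≡⟨ evaluate-ext (incFacts-factors m f∈) ⟩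
  ext σ                                                   ≡⟨ ext-∘-refl-top σ ⟨
  ext σ ∘ᵛ refl𝕍 (suc m) (top m) (top m)                  ≡⟨ cong (λ a → ext σ ∘ᵛ refl𝕍 (suc m) a (top m)) e ⟨
  ext σ ∘ᵛ refl𝕍 (suc m) (letter s (toℕ p)) (top m)       ≡⟨ displace-product s p σ ⟨
  displace s (letter s m) p σ                             ∎)
  where open ≡-Reasoning
... | f , f∈ , refl | no ≢ = f ++ (letter s (toℕ p) , suc m) ∷ [] ,
  ∈P.∈-++⁺ʳ (incFacts m) (∈-concatMap⁺ (appendFactor m) f∈ (∈P.∈-map⁺ (λ i → f ++ ((i , suc m) ∷ [])) (∈-firstB⁺ (Index-letter s p) ≢))) ,
  ≡-trans (evaluate-∷ʳ (incFacts-factors m f∈) (Index-letter s p)) (sym (displace-product s p σ))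

-- `sorD` evaluates the first factorization found. Every listed factorization of σ gives a growth
-- history with its sum as exponent of q, and all histories of σ agree, so the choice is immaterial.
-- The growth history itself provides a factorization, so the filtered list is not empty.
sorD-sorted : ∀ {n σ w} → Sorted n σ w → sorD σ ≡ proj₁ w
sorD-sorted {n} {σ} b with filterᵇ (λ f → prodᵛ (map (reflB n) f) ==ᵛ σ) (incFacts n) in eq
... | [] with sorted-factorization b
...   | f , f∈ , e with subst (f ∈_) eq (∈-filterᵇ⁺ (λ f → evaluate n f ==ᵛ σ) f∈ (fromWitness e))
...     | ()
sorD-sorted {n} {σ} b | f ∷ _ with ∈-filterᵇ⁻ (λ f → evaluate n f ==ᵛ σ) {xs = incFacts n} (subst (f ∈_) (sym eq) (here refl))
... | f∈ , e with evaluate-sorted n f∈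
...   | c , b′ = cong proj₁ (Sorting.Built-functional (subst (λ σ → Sorted n σ (sum (map sorTerm f) , c)) (toWitness e) b′) b)

theorem4p2 : (n : ℕ) → 2 ≤ n →
    (genFun n invD nminD ↭ genFun n sorD lD')
    × (genFun n sorD lD' ↭ prodPoly n)
theorem4p2 (suc m) _ = ↭-trans inv-nmin (↭-sym sor-length) , sor-length
  where
  inv-nmin : genFun (suc m) invD nminD ↭ prodPoly (suc m)
  inv-nmin = Insertion.genFun-↭-prodPoly m invD nminD (λ b _ → Inserted-stat b)
  sor-length : genFun (suc m) sorD lD' ↭ prodPoly (suc m)
  sor-length = Sorting.genFun-↭-prodPoly m sorD lD' (λ b ev → cong₂ _,_ (sorD-sorted b) (lD'-sorted b ev))
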